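{- Let $G=(V,E)$ be a forest with $|V|=n$. For every integer $k\ge 0$ with $2k\le n$, the coefficient of $p_{(2^k,1^{n-2k})}$ in the expansion of $X_G$ in the power-sum basis equals $(-1)^k m_k$, where $m_k$ is the number of $k$-matchings of $G$. Consequently the matching polynomial of $G$ is $$\mu_G(x)=\sum_{k}\bigl|c_{(2^k,1^{n-2k})}\bigr|\,x^k,$$ where $c_\lambda$ denotes the coefficient of $p_\lambda$ in $X_G$; in particular $\mu_G$ is determined by $X_G$.
   Context: For a graph $G=(V,E)$ with $V=\{v_1,\dots,v_n\}$, a proper coloring is a map $\kappa:V\to\mathbb{N}$ with $\kappa(u)\ne\kappa(v)$ whenever $(u,v)\in E$. The chromatic symmetric function is $X_G=\sum_\kappa x_{\kappa(v_1)}\cdots x_{\kappa(v_n)}$, summed over proper colorings. $p_m=\sum_{i\ge1}x_i^m$ and $p_\lambda=p_{\lambda_1}\cdots p_{\lambda_\ell}$ for a partition $\lambda$; the $p_\lambda$ form a basis of symmetric functions. The notation $(2^k,1^{j})$ denotes the partition with $k$ parts equal to $2$ and $j$ parts equal to $1$. A $k$-matching of $G$ is a set of $k$ edges, no two sharing an endpoint; the matching polynomial is $\mu_G(x)=\sum_k m_k x^k$ with $m_k$ the number of $k$-matchings. -}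

module Defs where

open import Data.Bool.Base using (if_then_else_)
open import Data.Fin.Base using (Fin)
open import Data.Fin.Properties using (_≟_; _<?_; all?)
open import Data.Integer.Base as ℤ using (ℤ; +_)
open import Data.List.Base
  using (List; []; _∷_; _∷ʳ_; _++_; [_]; map; filter; foldr; length; replicate;
         allFin; upTo; cartesianProduct; cartesianProductWith)
open import Data.List.Membership.Propositional using (_∉_)
open import Data.List.Relation.Unary.All using (All; []; _∷_)
open import Data.List.Relation.Unary.AllPairs using (allPairs?)
open import Data.List.Relation.Unary.Linked using (Linked; []; [-]; _∷_)
open import Data.List.Relation.Unary.Unique.Propositional using (Unique)
open import Data.Nat.Base as ℕ using (ℕ; zero; suc; _<_; _≥_; z≤n; s≤s; z<s)
import Data.Nat.Properties as ℕ
open import Data.Product.Base using (_×_; _,_)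
open import Data.Rational.Base as ℚ using (ℚ; 0ℚ; 1ℚ)
open import Data.Vec.Base as Vec using (Vec; []; _∷_; lookup; _[_]≔_)
import Data.Vec.Properties as Vec
open import Relation.Binary.Definitions using (Decidable; Symmetric; Irreflexive; DecidableEquality)
open import Relation.Binary.PropositionalEquality using (_≡_; _≢_)
open import Relation.Nullary.Decidable using (Dec; does; ¬?; _×-dec_; _→-dec_)
open import Relation.Nullary.Negation using (¬_)

fromℤ : ℤ → ℚ
fromℤ z = z ℚ./ 1

fromℕ : ℕ → ℚ
fromℕ m = fromℤ (+ m)

sumℚ : List ℚ → ℚ
sumℚ = foldr ℚ._+_ 0ℚ

------------------------------------------------------------------------
-- Graphs

record Graph (n : ℕ) : Set₁ where
  field
    Adj    : Fin n → Fin n → Set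
    adj?   : Decidable Adj
    sym    : Symmetric Adj
    irrefl : Irreflexive _≡_ Adj

open Graph public

-- The closed walk v, ws, v visits at least three vertices, each once.
record Cycle {n} (G : Graph n) (v : Fin n) (ws : List (Fin n)) : Set where
  field
    long     : length ws ≥ 2
    distinct : Unique (v ∷ ws)
    closed   : Linked (Adj G) (v ∷ ws ∷ʳ v)

Forest : ∀ {n} → Graph n → Set
Forest G = ∀ v ws → ¬ Cycle G v ws

-- Each edge {u , v} is listed once, as the pair with u < v.
edges : ∀ {n} → Graph n → List (Fin n × Fin n)
edges {n} G =
  filter (λ (u , v) → (u <? v) ×-dec adj? G u v) (cartesianProduct (allFin n) (allFin n))

------------------------------------------------------------------------
-- Matchings

Disjoint : ∀ {n} → Fin n × Fin n → Fin n × Fin n → Set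
Disjoint (u , v) (u′ , v′) = u ≢ u′ × u ≢ v′ × v ≢ u′ × v ≢ v′

disjoint? : ∀ {n} → Decidable (Disjoint {n})
disjoint? (u , v) (u′ , v′) =
  ¬? (u ≟ u′) ×-dec ¬? (u ≟ v′) ×-dec ¬? (v ≟ u′) ×-dec ¬? (v ≟ v′)

sublists : ∀ {A : Set} → List A → List (List A)
sublists []       = [ [] ]
sublists (x ∷ xs) = map (x ∷_) (sublists xs) ++ sublists xs

-- `edges G` has no repetitions, so its sublists are the sets of edges.
matchings : ∀ {n} → Graph n → ℕ → List (List (Fin n × Fin n))
matchings G k =
  filter (λ M → (length M ℕ.≟ k) ×-dec allPairs? disjoint? M) (sublists (edges G))

#matchings : ∀ {n} → Graph n → ℕ → ℕ
#matchings G k = length (matchings G k)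

-- A polynomial is its list of coefficients, constant term first; trailing
-- zeros are disregarded by _≈ᴾ_.
Polynomial : Set
Polynomial = List ℚ

coeff : Polynomial → ℕ → ℚ
coeff []      _       = 0ℚ
coeff (a ∷ _) zero    = a
coeff (_ ∷ f) (suc j) = coeff f j

infix 4 _≈ᴾ_
_≈ᴾ_ : Polynomial → Polynomial → Set
f ≈ᴾ g = ∀ j → coeff f j ≡ coeff g j

-- Σ_{k ≤ d} a k · x^k
∑≤ : ℕ → (ℕ → ℚ) → Polynomial
∑≤ d a = map a (upTo (suc d))

-- No k-matching has k > |E|.
matchingPolynomial : ∀ {n} → Graph n → Polynomial
matchingPolynomial G = ∑≤ (length (edges G)) (λ k → fromℕ (#matchings G k))

------------------------------------------------------------------------
-- Formal power series in the variables x₀, x₁, x₂, …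

-- f r α is the coefficient in f of the monomial x₀^α₀ ⋯ x_{r-1}^α_{r-1}, in
-- which the variables from x_r on do not occur.
Series : Set
Series = ∀ r → Vec ℕ r → ℚ

infix 4 _≈_
_≈_ : Series → Series → Set
f ≈ g = ∀ r (α : Vec ℕ r) → f r α ≡ g r α

_≟ᵛ_ : ∀ {r} → DecidableEquality (Vec ℕ r)
_≟ᵛ_ = Vec.≡-dec ℕ._≟_

𝟙 : Series
𝟙 r α = if does (α ≟ᵛ Vec.replicate r 0) then 1ℚ else 0ℚ

-- All (β , γ) with β + γ = α.
splits : ∀ {r} → Vec ℕ r → List (Vec ℕ r × Vec ℕ r)
splits []      = [ ([] , []) ]
splits (a ∷ α) =
  cartesianProductWith (λ b (β , γ) → (b ∷ β) , (a ℕ.∸ b ∷ γ)) (upTo (suc a)) (splits α)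

infixl 7 _·_
_·_ : Series → Series → Series
(f · g) r α = sumℚ (map (λ (β , γ) → f r β ℚ.* g r γ) (splits α))

-- p_m = Σᵢ xᵢ^m for m ≥ 1: the coefficient of x^α is the number of i for which
-- xᵢ^m = x^α.  Since m ≥ 1, only i < r can contribute.
powerSum : ℕ → Series
powerSum m r α =
  fromℕ (length (filter (λ i → α ≟ᵛ (Vec.replicate r 0 [ i ]≔ m)) (allFin r)))

------------------------------------------------------------------------
-- Partitions and power-sum expansions

record Partition : Set where
  constructor mkPartition
  field
    parts       : List ℕ
    .decreasing : Linked _≥_ parts
    .positive   : All (0 <_) parts

open Partition public

powerSumλ : Partition → Series
powerSumλ μ = foldr (λ m f → powerSum m · f) 𝟙 (parts μ)

-- f = Σ_μ c μ · p_μ, a linear combination with finite support: c vanishes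
-- outside the finite set of partitions listed by `support`.
record PowerSumExpansion (f : Series) (c : Partition → ℚ) : Set where
  field
    support   : List Partition
    unique    : Unique support
    vanishes  : ∀ μ → μ ∉ support → c μ ≡ 0ℚ
    expansion : f ≈ λ r α → sumℚ (map (λ μ → c μ ℚ.* powerSumλ μ r α) support)

twosOnes : ℕ → ℕ → Partition
twosOnes k j = mkPartition (replicate k 2 ++ replicate j 1) (decr k j) (pos k j)
  where
  decr : ∀ k j → Linked _≥_ (replicate k 2 ++ replicate j 1)
  decr zero          zero          = []
  decr zero          (suc zero)    = [-]
  decr zero          (suc (suc j)) = ℕ.≤-refl ∷ decr zero (suc j)
  decr (suc zero)    zero          = [-]
  decr (suc zero)    (suc j)       = s≤s z≤n ∷ decr zero (suc j)
  decr (suc (suc k)) j             = ℕ.≤-refl ∷ decr (suc k) j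

  pos : ∀ k j → All (0 <_) (replicate k 2 ++ replicate j 1)
  pos zero    zero    = []
  pos zero    (suc j) = z<s ∷ pos zero j
  pos (suc k) j       = z<s ∷ pos k j

------------------------------------------------------------------------
-- The chromatic symmetric function

Proper : ∀ {n} → Graph n → {C : Set} → (Fin n → C) → Set
Proper G κ = ∀ u v → Adj G u v → κ u ≢ κ v

proper? : ∀ {n} (G : Graph n) {r} (κ : Fin n → Fin r) → Dec (Proper G κ)
proper? G κ = all? λ u → all? λ v → adj? G u v →-dec ¬? (κ u ≟ κ v)

-- All maps Fin n → Fin r, as vectors of values.
maps : ∀ n r → List (Vec (Fin r) n)
maps zero    r = [ [] ]
maps (suc n) r = cartesianProductWith _∷_ (allFin r) (maps n r)

-- The exponents of the monomial Π_v x_{κ(v)}.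
content : ∀ {n r} → (Fin n → Fin r) → Vec ℕ r
content {n} κ = Vec.tabulate λ i → length (filter (λ v → κ v ≟ i) (allFin n))

-- The coefficient of x^α is the number of proper colourings κ with
-- Π_v x_{κ(v)} = x^α.  A colouring by natural numbers with this property uses
-- only colours below r, so it suffices to count maps into Fin r.
chromatic : ∀ {n} → Graph n → Series
chromatic {n} G r α =
  fromℕ (length (filter
    (λ κ → proper? G (lookup κ) ×-dec (content (lookup κ) ≟ᵛ α)) (maps n r)))

{-# OPTIONS --safe #-}

-- Deletion–contraction, X_G = X_{G∖e} − X_{G/e} with a contracted vertex carrying
-- the total weight of the vertices merged into it, expands X_G as the sum over
-- sets S of edges of ± p_λ, where λ lists the weights left after contracting S.
-- Weights never decrease, so a set S contributes to p_{(2^k,1^{n-2k})} only if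
-- every contraction merges two vertices of weight 1, that is, if S is a
-- k-matching.  Coefficients are well defined because x^μ occurs in p_μ, and
-- occurs in p_ν with ν ≠ μ only if ν has more parts than μ.

module Submission where

open import Defs hiding (sym)
open import Algebra.Properties.CommutativeSemigroup using (interchange; x∙yz≈y∙xz)
open import Algebra.Properties.Group using (x∙y⁻¹≈ε⇒x≈y)
open import Data.Bool.Base using (if_then_else_)
open import Data.Fin.Base as Fin using (Fin; zero; suc; punchIn; punchOut)
import Data.Fin.Properties as Fin
open import Data.Integer.Base as ℤ using (+_; -1ℤ)
import Data.Integer.Properties as ℤ
open import Data.Integer.Solver renaming (module +-*-Solver to ℤ-Solver)
open import Data.List.Base as List
  using (List; []; _∷_; _++_; map; filter; foldr; length; replicate; tabulate; allFin;
         upTo; applyUpTo; cartesianProduct; cartesianProductWith; deduplicate)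
open import Data.List.Extrema.Nat using (max; xs≤max)
import Data.List.Membership.DecPropositional as DecMembership
open import Data.List.Membership.Propositional using (_∈_; _∉_)
open import Data.List.Membership.Propositional.Properties
open import Data.List.Properties
  using (≡-dec; filter-none; length-++; length-replicate; length-tabulate; map-cong-local;
         map-tabulate; tabulate-lookup)
open import Data.List.Relation.Binary.Permutation.Propositional as Perm
  using (_↭_; prep; swap; ↭-sym; ↭-trans; ↭-reflexive)
open import Data.List.Relation.Binary.Permutation.Propositional.Properties
  using (↭-length; All-resp-↭; shift)
open import Data.List.Relation.Binary.Pointwise using (Pointwise-≡⇒≡)
open import Data.List.Relation.Binary.Sublist.Propositional using (_⊆_; []; _∷_; _∷ʳ_)
open import Data.List.Relation.Binary.Sublist.Propositional.Properties
  using (All-resp-⊆; length-mono-≤)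
open import Data.List.Relation.Unary.All as All using (All; []; _∷_)
import Data.List.Relation.Unary.All.Properties as All
open import Data.List.Relation.Unary.AllPairs using (AllPairs; []; _∷_; allPairs?)
open import Data.List.Relation.Unary.Any using (here; there)
open import Data.List.Relation.Unary.Linked using (linked?)
import Data.List.Relation.Unary.Sorted.TotalOrder.Properties as Sorted
import Data.List.Relation.Unary.Unique.DecPropositional.Properties as DecUnique
open import Data.List.Relation.Unary.Unique.Propositional using (Unique)
import Data.List.Relation.Unary.Unique.Propositional.Properties as Unique
import Data.List.Sort as Sort
open import Data.Nat.Base as ℕ
  using (ℕ; zero; suc; _*_; _∸_; _≤_; _<_; ⌊_/2⌋; s≤s; z≤n)
open import Data.Nat.ListAction using (sum)
import Data.Nat.ListAction.Properties as ℕ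
import Data.Nat.Properties as ℕ
open import Data.Product.Base using (_×_; _,_; proj₁; proj₂; map₁; ∃-syntax)
open import Data.Rational.Base as ℚ using (ℚ; 0ℚ; 1ℚ; ∣_∣)
import Data.Rational.Properties as ℚ
open import Data.Rational.Solver using (module +-*-Solver)
open import Data.Rational.Unnormalised.Base as ℚᵘ using (mkℚᵘ; *≡*)
import Data.Rational.Unnormalised.Properties as ℚᵘ
open import Data.Sum.Base using (_⊎_; inj₁; inj₂)
open import Data.Vec.Base as Vec
  using (Vec; []; _∷_; fromList; toList; insertAt; lookup; _[_]≔_)
import Data.Vec.Functional as F
import Data.Vec.Functional.Properties as F
import Data.Vec.Properties as Vec
open import Function.Base using (_∘_; id)
open import Relation.Binary.Bundles using (DecTotalOrder)
import Relation.Binary.Construct.Flip.EqAndOrd as Flip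
open import Relation.Binary.Definitions using (DecidableEquality; tri<; tri≈; tri>)
open import Relation.Binary.PropositionalEquality
  using (_≡_; _≢_; refl; sym; trans; cong; cong₂; subst; subst₂; module ≡-Reasoning)
open import Relation.Nullary using (Dec; yes; no; does; ¬_; contradiction)
open import Relation.Nullary.Decidable
  using (dec-true; dec-false; decidable-stable; map′; recompute; ¬?; _×-dec_)

open ≡-Reasoning

-- Contraction never rebuilds a graph. The edges stay pairs of original vertices, a map `π` sends
-- each vertex to its current block, and `w` gives the weights of the blocks. Parallel edges then
-- need no treatment, and an edge with both ends in one block is a loop, which makes the series
-- zero. The delicate point is that a branch could be lost to a loop although its contracted edges
-- form a matching. The invariant `Small` excludes this: as long as only blocks of weight 1 are
-- merged, a new loop would have to repeat the contracted edge. Every other branch contains a block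
-- of weight at least 3 and contributes nothing. Identities of series are checked coefficientwise,
-- with both sides written as sums of 0/1 indicators over all maps into `r` colours. A product of
-- power sums is then the chromatic series of a weighted graph without edges, the end of the
-- recursion.

private variable
  A B : Set
  P Q : Set
  n r ℓ : ℕ

-- Indicators and sums

toℚᵘ-fromℤ : ∀ z → ℚ.toℚᵘ (fromℤ z) ℚᵘ.≃ mkℚᵘ z 0
toℚᵘ-fromℤ z = ℚ.toℚᵘ-fromℚᵘ (mkℚᵘ z 0)

fromℤ-+ : ∀ a b → fromℤ (a ℤ.+ b) ≡ fromℤ a ℚ.+ fromℤ b
fromℤ-+ a b = ℚ.toℚᵘ-injective
  (ℚᵘ.≃-trans (toℚᵘ-fromℤ (a ℤ.+ b)) (ℚᵘ.≃-trans (*≡* eq) (ℚᵘ.≃-sym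
    (ℚᵘ.≃-trans (ℚ.toℚᵘ-homo-+ (fromℤ a) (fromℤ b))
                (ℚᵘ.+-cong (toℚᵘ-fromℤ a) (toℚᵘ-fromℤ b))))))
  where
  open ℤ-Solver
  eq : (a ℤ.+ b) ℤ.* (+ 1) ≡ (a ℤ.* + 1 ℤ.+ b ℤ.* + 1) ℤ.* + 1
  eq = solve 2 (λ a b → (a :+ b) :* con (+ 1) := (a :* con (+ 1) :+ b :* con (+ 1)) :* con (+ 1))
    refl a b

fromℤ-* : ∀ a b → fromℤ (a ℤ.* b) ≡ fromℤ a ℚ.* fromℤ b
fromℤ-* a b = ℚ.toℚᵘ-injective
  (ℚᵘ.≃-trans (toℚᵘ-fromℤ (a ℤ.* b)) (ℚᵘ.≃-trans (*≡* refl) (ℚᵘ.≃-sym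
    (ℚᵘ.≃-trans (ℚ.toℚᵘ-homo-* (fromℤ a) (fromℤ b))
                (ℚᵘ.*-cong (toℚᵘ-fromℤ a) (toℚᵘ-fromℤ b))))))

fromℕ-suc : ∀ m → fromℕ (suc m) ≡ 1ℚ ℚ.+ fromℕ m
fromℕ-suc m = fromℤ-+ (+ 1) (+ m)

fromℕ≡0⇒≡0 : ∀ m → fromℕ m ≡ 0ℚ → m ≡ 0
fromℕ≡0⇒≡0 m eq = ℤ.+-injective (trans (sym (ℤ.*-identityʳ (+ m)))
  (ℚᵘ.drop-*≡* (ℚᵘ.≃-trans (ℚᵘ.≃-sym (toℚᵘ-fromℤ (+ m)))
    (ℚᵘ.≃-reflexive (cong ℚ.toℚᵘ eq)))))

⟦_⟧ : Dec P → ℚ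
⟦ P? ⟧ = if does P? then 1ℚ else 0ℚ

⟦⟧-true : (P? : Dec P) → P → ⟦ P? ⟧ ≡ 1ℚ
⟦⟧-true P? p rewrite dec-true P? p = refl

⟦⟧-false : (P? : Dec P) → ¬ P → ⟦ P? ⟧ ≡ 0ℚ
⟦⟧-false P? ¬p rewrite dec-false P? ¬p = refl

⟦⟧-cong : (P? : Dec P) (Q? : Dec Q) → (P → Q) → (Q → P) → ⟦ P? ⟧ ≡ ⟦ Q? ⟧
⟦⟧-cong (yes p) Q? P⇒Q Q⇒P = sym (⟦⟧-true Q? (P⇒Q p))
⟦⟧-cong (no ¬p) Q? P⇒Q Q⇒P = sym (⟦⟧-false Q? (¬p ∘ Q⇒P))

⟦⟧-× : (P? : Dec P) (Q? : Dec Q) → ⟦ P? ×-dec Q? ⟧ ≡ ⟦ P? ⟧ ℚ.* ⟦ Q? ⟧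
⟦⟧-× (yes _) Q? = sym (ℚ.*-identityˡ ⟦ Q? ⟧)
⟦⟧-× (no _)  Q? = sym (ℚ.*-zeroˡ ⟦ Q? ⟧)

⟦⟧-absorb : ∀ (P? : Dec P) {q} → (¬ P → q ≡ 0ℚ) → ⟦ P? ⟧ ℚ.* q ≡ q
⟦⟧-absorb (yes _) {q} ¬P⇒q≡0 = ℚ.*-identityˡ q
⟦⟧-absorb (no ¬p) {q} ¬P⇒q≡0 = trans (ℚ.*-zeroˡ q) (sym (¬P⇒q≡0 ¬p))

interchange-+ : ∀ a b c d → (a ℚ.+ b) ℚ.+ (c ℚ.+ d) ≡ (a ℚ.+ c) ℚ.+ (b ℚ.+ d)
interchange-+ = solve 4 (λ a b c d → (a :+ b) :+ (c :+ d) := (a :+ c) :+ (b :+ d)) refl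
  where open +-*-Solver

interchange-* : ∀ a b c d → (a ℚ.* b) ℚ.* (c ℚ.* d) ≡ (a ℚ.* c) ℚ.* (b ℚ.* d)
interchange-* = solve 4 (λ a b c d → (a :* b) :* (c :* d) := (a :* c) :* (b :* d)) refl
  where open +-*-Solver

∑ : List A → (A → ℚ) → ℚ
∑ xs f = sumℚ (map f xs)

∑-cong : ∀ (xs : List A) {f g : A → ℚ} → (∀ x → f x ≡ g x) → ∑ xs f ≡ ∑ xs g
∑-cong []       f≗g = refl
∑-cong (x ∷ xs) f≗g = cong₂ ℚ._+_ (f≗g x) (∑-cong xs f≗g)

∑-zero : ∀ (xs : List A) {f : A → ℚ} → (∀ x → f x ≡ 0ℚ) → ∑ xs f ≡ 0ℚ
∑-zero []       f≗0 = refl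
∑-zero (x ∷ xs) f≗0 = cong₂ ℚ._+_ (f≗0 x) (∑-zero xs f≗0)

∑-++ : ∀ (xs ys : List A) (f : A → ℚ) → ∑ (xs ++ ys) f ≡ ∑ xs f ℚ.+ ∑ ys f
∑-++ []       ys f = sym (ℚ.+-identityˡ (∑ ys f))
∑-++ (x ∷ xs) ys f = trans (cong (f x ℚ.+_) (∑-++ xs ys f)) (sym (ℚ.+-assoc (f x) _ _))

∑-map : ∀ (g : A → B) (xs : List A) (f : B → ℚ) → ∑ (map g xs) f ≡ ∑ xs (f ∘ g)
∑-map g []       f = refl
∑-map g (x ∷ xs) f = cong (f (g x) ℚ.+_) (∑-map g xs f)

∑-+ : ∀ (xs : List A) (f g : A → ℚ) → ∑ xs (λ x → f x ℚ.+ g x) ≡ ∑ xs f ℚ.+ ∑ xs g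
∑-+ []       f g = refl
∑-+ (x ∷ xs) f g = trans (cong (f x ℚ.+ g x ℚ.+_) (∑-+ xs f g)) (interchange-+ (f x) (g x) _ _)

∑-*ˡ : ∀ a (xs : List A) (f : A → ℚ) → ∑ xs (λ x → a ℚ.* f x) ≡ a ℚ.* ∑ xs f
∑-*ˡ a []       f = sym (ℚ.*-zeroʳ a)
∑-*ˡ a (x ∷ xs) f = trans (cong (a ℚ.* f x ℚ.+_) (∑-*ˡ a xs f)) (sym (ℚ.*-distribˡ-+ a (f x) _))

∑-*ʳ : ∀ a (xs : List A) (f : A → ℚ) → ∑ xs (λ x → f x ℚ.* a) ≡ ∑ xs f ℚ.* a
∑-*ʳ a xs f = trans (∑-cong xs (λ x → ℚ.*-comm (f x) a)) (trans (∑-*ˡ a xs f) (ℚ.*-comm a _))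

∑-neg : ∀ (xs : List A) (f : A → ℚ) → ∑ xs (λ x → ℚ.- f x) ≡ ℚ.- ∑ xs f
∑-neg []       f = refl
∑-neg (x ∷ xs) f = trans (cong (ℚ.- f x ℚ.+_) (∑-neg xs f)) (sym (ℚ.neg-distrib-+ (f x) _))

∑-swap : ∀ (xs : List A) (ys : List B) (f : A → B → ℚ) →
         ∑ xs (λ x → ∑ ys (f x)) ≡ ∑ ys (λ y → ∑ xs (λ x → f x y))
∑-swap []       ys f = sym (∑-zero ys (λ _ → refl))
∑-swap (x ∷ xs) ys f = trans (cong (∑ ys (f x) ℚ.+_) (∑-swap xs ys f))
  (sym (∑-+ ys (f x) (λ y → ∑ xs (λ x → f x y))))

∑-product : ∀ {C : Set} (_⊗_ : A → B → C) xs ys (f : C → ℚ) →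
            ∑ (cartesianProductWith _⊗_ xs ys) f ≡ ∑ xs (λ x → ∑ ys (λ y → f (x ⊗ y)))
∑-product _⊗_ []       ys f = refl
∑-product _⊗_ (x ∷ xs) ys f = trans (∑-++ (map (x ⊗_) ys) _ f)
  (cong₂ ℚ._+_ (∑-map (x ⊗_) ys f) (∑-product _⊗_ xs ys f))

fromℕ-length-filter : ∀ {P : A → Set} (P? : ∀ x → Dec (P x)) xs →
  fromℕ (length (filter P? xs)) ≡ ∑ xs (λ x → ⟦ P? x ⟧)
fromℕ-length-filter P? []       = refl
fromℕ-length-filter P? (x ∷ xs) with P? x
... | yes _ = trans (fromℕ-suc (length (filter P? xs))) (cong (1ℚ ℚ.+_) (fromℕ-length-filter P? xs))
... | no _  = trans (fromℕ-length-filter P? xs) (sym (ℚ.+-identityˡ _))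

module _ (_≟_ : DecidableEquality A) where

  ∑-δ-∉ : ∀ {xs x} (f : A → ℚ) → x ∉ xs → ∑ xs (λ y → ⟦ y ≟ x ⟧ ℚ.* f y) ≡ 0ℚ
  ∑-δ-∉ {[]}     f x∉ = refl
  ∑-δ-∉ {y ∷ xs} {x} f x∉ = cong₂ ℚ._+_
    (trans (cong (ℚ._* f y) (⟦⟧-false (y ≟ x) (x∉ ∘ here ∘ sym))) (ℚ.*-zeroˡ (f y)))
    (∑-δ-∉ f (x∉ ∘ there))

  ∑-δ : ∀ {xs x} (f : A → ℚ) → Unique xs → x ∈ xs → ∑ xs (λ y → ⟦ y ≟ x ⟧ ℚ.* f y) ≡ f x
  ∑-δ {y ∷ xs} {x} f (y∉xs ∷ _) (here refl) = trans (cong₂ ℚ._+_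
    (trans (cong (ℚ._* f y) (⟦⟧-true (y ≟ x) refl)) (ℚ.*-identityˡ (f y)))
    (∑-δ-∉ f (λ x∈xs → All.lookup y∉xs x∈xs refl))) (ℚ.+-identityʳ (f y))
  ∑-δ {y ∷ xs} {x} f (y∉xs ∷ u) (there x∈xs) = trans (cong₂ ℚ._+_
    (trans (cong (ℚ._* f y) (⟦⟧-false (y ≟ x) (All.lookup y∉xs x∈xs))) (ℚ.*-zeroˡ (f y)))
    (∑-δ f u x∈xs)) (ℚ.+-identityˡ (f x))

-- Products of series

infixl 6 _⊕_
_⊕_ : ∀ {r} → Vec ℕ r → Vec ℕ r → Vec ℕ r
_⊕_ = Vec.zipWith ℕ._+_

-- Only `x = b` can contribute. The range `x ≤ a` keeps the subtraction from being truncated, and if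
-- `b` lies outside it, then `b + g` exceeds `a` as well.
∑-upTo-splits : ∀ a b g →
  ∑ (upTo (suc a)) (λ x → ⟦ x ℕ.≟ b ⟧ ℚ.* ⟦ g ℕ.≟ a ℕ.∸ x ⟧) ≡ ⟦ b ℕ.+ g ℕ.≟ a ⟧
∑-upTo-splits a b g with b ℕ.≤? a
... | yes b≤a = trans
  (∑-δ ℕ._≟_ (λ x → ⟦ g ℕ.≟ a ℕ.∸ x ⟧) (Unique.upTo⁺ (suc a)) (∈-upTo⁺ (s≤s b≤a)))
  (⟦⟧-cong (g ℕ.≟ a ℕ.∸ b) (b ℕ.+ g ℕ.≟ a)
    (λ { refl → ℕ.m+[n∸m]≡n b≤a }) (λ { refl → sym (ℕ.m+n∸m≡n b g) }))
... | no b≰a = trans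
  (∑-δ-∉ ℕ._≟_ {upTo (suc a)} (λ x → ⟦ g ℕ.≟ a ℕ.∸ x ⟧) (b≰a ∘ ℕ.s≤s⁻¹ ∘ ∈-upTo⁻))
  (sym (⟦⟧-false (b ℕ.+ g ℕ.≟ a) (λ { refl → b≰a (ℕ.m≤m+n b g) })))

⟦⟧-∷ : ∀ {r} a b (α β : Vec ℕ r) →
       ⟦ (a ∷ α) ≟ᵛ (b ∷ β) ⟧ ≡ ⟦ a ℕ.≟ b ⟧ ℚ.* ⟦ α ≟ᵛ β ⟧
⟦⟧-∷ a b α β = ⟦⟧-× (a ℕ.≟ b) (α ≟ᵛ β)

-- The rule x^β · x^γ = x^(β ⊕ γ) for monomials. The two indicators face opposite ways to fit
-- `powerSum` on the left and a colouring count on the right.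
∑-splits : ∀ {r} (α β γ : Vec ℕ r) →
  ∑ (splits α) (λ (β′ , γ′) → ⟦ β′ ≟ᵛ β ⟧ ℚ.* ⟦ γ ≟ᵛ γ′ ⟧) ≡ ⟦ (β ⊕ γ) ≟ᵛ α ⟧
∑-splits []      []      []      = refl
∑-splits (a ∷ α) (b ∷ β) (g ∷ γ) = begin
  ∑ (splits (a ∷ α)) (λ (β′ , γ′) → ⟦ β′ ≟ᵛ (b ∷ β) ⟧ ℚ.* ⟦ (g ∷ γ) ≟ᵛ γ′ ⟧)
    ≡⟨ ∑-product _ (upTo (suc a)) (splits α) _ ⟩
  ∑ (upTo (suc a)) (λ x → ∑ (splits α) (λ (β′ , γ′) →
    ⟦ (x ∷ β′) ≟ᵛ (b ∷ β) ⟧ ℚ.* ⟦ (g ∷ γ) ≟ᵛ (a ℕ.∸ x ∷ γ′) ⟧))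
    ≡⟨ ∑-cong (upTo (suc a)) (λ x → trans
         (∑-cong (splits α) (λ (β′ , γ′) → trans
           (cong₂ ℚ._*_ (⟦⟧-∷ x b β′ β) (⟦⟧-∷ g (a ℕ.∸ x) γ γ′))
           (interchange-* ⟦ x ℕ.≟ b ⟧ _ _ _)))
         (∑-*ˡ (⟦ x ℕ.≟ b ⟧ ℚ.* ⟦ g ℕ.≟ a ℕ.∸ x ⟧) (splits α) _)) ⟩
  ∑ (upTo (suc a)) (λ x → ⟦ x ℕ.≟ b ⟧ ℚ.* ⟦ g ℕ.≟ a ℕ.∸ x ⟧ ℚ.* S)
    ≡⟨ ∑-*ʳ S (upTo (suc a)) (λ x → ⟦ x ℕ.≟ b ⟧ ℚ.* ⟦ g ℕ.≟ a ℕ.∸ x ⟧) ⟩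
  ∑ (upTo (suc a)) (λ x → ⟦ x ℕ.≟ b ⟧ ℚ.* ⟦ g ℕ.≟ a ℕ.∸ x ⟧) ℚ.* S
    ≡⟨ cong₂ ℚ._*_ (∑-upTo-splits a b g) (∑-splits α β γ) ⟩
  ⟦ b ℕ.+ g ℕ.≟ a ⟧ ℚ.* ⟦ (β ⊕ γ) ≟ᵛ α ⟧
    ≡⟨ ⟦⟧-∷ (b ℕ.+ g) a (β ⊕ γ) α ⟨
  ⟦ ((b ∷ β) ⊕ (g ∷ γ)) ≟ᵛ (a ∷ α) ⟧ ∎
  where
  S : ℚ
  S = ∑ (splits α) (λ (β′ , γ′) → ⟦ β′ ≟ᵛ β ⟧ ℚ.* ⟦ γ ≟ᵛ γ′ ⟧)

⊕-comm : (α β : Vec ℕ r) → α ⊕ β ≡ β ⊕ α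
⊕-comm = Vec.zipWith-comm ℕ.+-comm

⊕-assoc : (α β γ : Vec ℕ r) → (α ⊕ β) ⊕ γ ≡ α ⊕ (β ⊕ γ)
⊕-assoc = Vec.zipWith-assoc ℕ.+-assoc

⊕-exchange : (α β γ : Vec ℕ r) → α ⊕ (β ⊕ γ) ≡ β ⊕ (α ⊕ γ)
⊕-exchange α β γ =
  trans (sym (⊕-assoc α β γ)) (trans (cong (_⊕ γ) (⊕-comm α β)) (⊕-assoc β α γ))

⊕-identityˡ : (α : Vec ℕ r) → Vec.replicate r 0 ⊕ α ≡ α
⊕-identityˡ = Vec.zipWith-identityˡ ℕ.+-identityˡ

single : Fin r → ℕ → Vec ℕ r
single {r} i m = Vec.replicate r 0 [ i ]≔ m

-- The exponents of the monomial Π_j x_{κ(j)}^{w(j)}.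
weightedContent : (Fin n → ℕ) → Vec (Fin r) n → Vec ℕ r
weightedContent {r = r} w [] = Vec.replicate r 0
weightedContent w (i ∷ κ) = single i (w zero) ⊕ weightedContent (w ∘ suc) κ

-- `powerSumλ` freed from partitions: block weights come in no particular order.
pProduct : List ℕ → Series
pProduct = foldr (λ m f → powerSum m · f) 𝟙

-- Multiplying out the factors Σᵢ xᵢ^(w j), the choice of one variable from each factor is a
-- colouring, subject to no condition.
pProduct-tabulate : ∀ (w : Fin n → ℕ) r α →
  pProduct (tabulate w) r α ≡ ∑ (maps n r) (λ κ → ⟦ weightedContent w κ ≟ᵛ α ⟧)
pProduct-tabulate {zero} w r α = trans
  (⟦⟧-cong (α ≟ᵛ Vec.replicate r 0) (Vec.replicate r 0 ≟ᵛ α) sym sym) (sym (ℚ.+-identityʳ _))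
pProduct-tabulate {suc n} w r α = begin
  ∑ (splits α) (λ (β , γ) → powerSum m r β ℚ.* pProduct (tabulate (w ∘ suc)) r γ)
    ≡⟨ ∑-cong (splits α) (λ (β , γ) → trans
         (cong₂ ℚ._*_ (fromℕ-length-filter (λ i → β ≟ᵛ single i m) (allFin r)) (pProduct-tabulate (w ∘ suc) r γ))
         (sym (trans
           (∑-cong (allFin r) (λ i → ∑-*ˡ ⟦ β ≟ᵛ single i m ⟧ (maps n r) (λ κ → ⟦ wc κ ≟ᵛ γ ⟧)))
           (∑-*ʳ _ (allFin r) (λ i → ⟦ β ≟ᵛ single i m ⟧))))) ⟩
  ∑ (splits α) (λ (β , γ) → ∑ (allFin r) (λ i → ∑ (maps n r) (λ κ →
    ⟦ β ≟ᵛ single i m ⟧ ℚ.* ⟦ wc κ ≟ᵛ γ ⟧)))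
    ≡⟨ ∑-swap (splits α) (allFin r) _ ⟩
  ∑ (allFin r) (λ i → ∑ (splits α) (λ (β , γ) → ∑ (maps n r) (λ κ →
    ⟦ β ≟ᵛ single i m ⟧ ℚ.* ⟦ wc κ ≟ᵛ γ ⟧)))
    ≡⟨ ∑-cong (allFin r) (λ i → trans (∑-swap (splits α) (maps n r) _)
         (∑-cong (maps n r) (λ κ → ∑-splits α (single i m) (wc κ)))) ⟩
  ∑ (allFin r) (λ i → ∑ (maps n r) (λ κ → ⟦ (single i m ⊕ wc κ) ≟ᵛ α ⟧))
    ≡⟨ ∑-product _∷_ (allFin r) (maps n r) (λ κ → ⟦ weightedContent w κ ≟ᵛ α ⟧) ⟨
  ∑ (maps (suc n) r) (λ κ → ⟦ weightedContent w κ ≟ᵛ α ⟧) ∎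
  where
  m : ℕ
  m = w zero
  wc : Vec (Fin r) n → Vec ℕ r
  wc = weightedContent (w ∘ suc)

·-congˡ : ∀ (f : Series) {g h} → g ≈ h → f · g ≈ f · h
·-congˡ f g≈h r α = ∑-cong (splits α) (λ (β , γ) → cong (f r β ℚ.*_) (g≈h r γ))

-- Avoids associativity and commutativity of `·`: in the sum over colourings, exchanging the first
-- two factors just exchanges the sums over their colours.
pProduct-swap : ∀ a b ms → pProduct (a ∷ b ∷ ms) ≈ pProduct (b ∷ a ∷ ms)
pProduct-swap a b ms r α = trans (expand a b) (trans
  (trans (∑-swap (allFin r) (allFin r) _)
    (∑-cong (allFin r) (λ j → ∑-cong (allFin r) (λ i → ∑-cong (maps n′ r) (λ κ →
      cong (λ β → ⟦ β ≟ᵛ α ⟧) (⊕-exchange (single i a) (single j b) (weightedContent w κ)))))))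
  (sym (expand b a)))
  where
  n′ : ℕ
  n′ = length ms
  w : Fin n′ → ℕ
  w = List.lookup ms
  expand : ∀ a b → pProduct (a ∷ b ∷ ms) r α ≡
    ∑ (allFin r) (λ i → ∑ (allFin r) (λ j → ∑ (maps n′ r) (λ κ →
      ⟦ (single i a ⊕ (single j b ⊕ weightedContent w κ)) ≟ᵛ α ⟧)))
  expand a b = begin
    pProduct (a ∷ b ∷ ms) r α
      ≡⟨ cong (λ ks → pProduct (a ∷ b ∷ ks) r α) (tabulate-lookup ms) ⟨
    pProduct (tabulate (a F.∷ (b F.∷ w))) r α
      ≡⟨ pProduct-tabulate (a F.∷ (b F.∷ w)) r α ⟩
    ∑ (maps (suc (suc n′)) r) f
      ≡⟨ ∑-product _∷_ (allFin r) (maps (suc n′) r) f ⟩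
    ∑ (allFin r) (λ i → ∑ (maps (suc n′) r) (λ κ → f (i ∷ κ)))
      ≡⟨ ∑-cong (allFin r) (λ i → ∑-product _∷_ (allFin r) (maps n′ r) (λ κ → f (i ∷ κ))) ⟩
    _ ∎
    where
    f : Vec (Fin r) (suc (suc n′)) → ℚ
    f κ = ⟦ weightedContent (a F.∷ (b F.∷ w)) κ ≟ᵛ α ⟧

pProduct-↭ : ∀ {ks ms} → ks ↭ ms → pProduct ks ≈ pProduct ms
pProduct-↭ Perm.refl r α = refl
pProduct-↭ (prep a p) = ·-congˡ (powerSum a) (pProduct-↭ p)
pProduct-↭ {ks = _ ∷ _ ∷ ks} (swap a b p) r α = trans (pProduct-swap a b ks r α)
  (·-congˡ (powerSum b) (·-congˡ (powerSum a) (pProduct-↭ p)) r α)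
pProduct-↭ (Perm.trans p q) r α = trans (pProduct-↭ p r α) (pProduct-↭ q r α)

-- Linear independence of the power sums

≥-decTotalOrder : DecTotalOrder _ _ _
≥-decTotalOrder = Flip.decTotalOrder ℕ.≤-decTotalOrder

partition-≡ : ∀ {μ ν} → parts μ ≡ parts ν → μ ≡ ν
partition-≡ {mkPartition _ _ _} {mkPartition _ _ _} refl = refl

_≟ᴾ_ : DecidableEquality Partition
μ ≟ᴾ ν = map′ partition-≡ (cong parts) (≡-dec ℕ._≟_ (parts μ) (parts ν))

-- Sorted lists that are permutations of each other coincide. The sortedness proofs are irrelevant
-- fields, recovered by deciding sortedness.
partition-↭ : ∀ {μ ν} → parts μ ↭ parts ν → μ ≡ ν
partition-↭ {mkPartition ks k↘ _} {mkPartition ms m↘ _} p = partition-≡ (Pointwise-≡⇒≡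
  (Sorted.↗↭↗⇒≋ (DecTotalOrder.totalOrder ≥-decTotalOrder)
    (recompute (linked? ℕ._≥?_ ks) k↘) (recompute (linked? ℕ._≥?_ ms) m↘) (Perm.↭⇒↭ₛ p)))

positive-parts : ∀ μ → All (0 <_) (parts μ)
positive-parts (mkPartition ms _ ms>0) = recompute (All.all? (0 ℕ.<?_) ms) ms>0

nonzeros : Vec ℕ r → List ℕ
nonzeros α = filter (λ a → ¬? (a ℕ.≟ 0)) (toList α)

nonzeros-single⊕ : ∀ (i : Fin r) m α →
  length (nonzeros (single i m ⊕ α)) ≤ length (nonzeros α) ⊎ nonzeros (single i m ⊕ α) ↭ m ∷ nonzeros α
nonzeros-single⊕ zero zero    (zero ∷ α)  rewrite ⊕-identityˡ α = inj₁ ℕ.≤-refl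
nonzeros-single⊕ zero (suc m) (zero ∷ α)  rewrite ⊕-identityˡ α | ℕ.+-identityʳ m = inj₂ Perm.refl
nonzeros-single⊕ zero zero    (suc a ∷ α) rewrite ⊕-identityˡ α = inj₁ ℕ.≤-refl
nonzeros-single⊕ zero (suc m) (suc a ∷ α) rewrite ⊕-identityˡ α = inj₁ ℕ.≤-refl
nonzeros-single⊕ (suc i) m (zero ∷ α) = nonzeros-single⊕ i m α
nonzeros-single⊕ (suc i) m (suc a ∷ α) with nonzeros-single⊕ i m α
... | inj₁ shorter = inj₁ (s≤s shorter)
... | inj₂ perm    = inj₂ (↭-trans (prep (suc a) perm) (swap (suc a) m Perm.refl))

-- The source of triangularity: a repeated colour (or a weight 0) loses a variable from the
-- monomial, whereas an injective colouring of positive weights has exactly these weights as its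
-- exponents.
nonzeros-weightedContent : ∀ (w : Fin n → ℕ) (κ : Vec (Fin r) n) →
  length (nonzeros (weightedContent w κ)) < n ⊎ nonzeros (weightedContent w κ) ↭ tabulate w
nonzeros-weightedContent {r = r} w [] = inj₂ (↭-reflexive (nonzeros-replicate r))
  where
  nonzeros-replicate : ∀ r → nonzeros (Vec.replicate r 0) ≡ []
  nonzeros-replicate zero    = refl
  nonzeros-replicate (suc r) = nonzeros-replicate r
nonzeros-weightedContent w (i ∷ κ)
  with nonzeros-single⊕ i (w zero) (weightedContent (w ∘ suc) κ) | nonzeros-weightedContent (w ∘ suc) κ
... | inj₁ shorter | inj₁ short = inj₁ (s≤s (ℕ.≤-trans shorter (ℕ.<⇒≤ short)))
... | inj₂ perm    | inj₁ short = inj₁ (s≤s (ℕ.≤-trans (ℕ.≤-reflexive (↭-length perm)) short))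
... | inj₁ shorter | inj₂ perm′ = inj₁ (s≤s (ℕ.≤-trans shorter
  (ℕ.≤-reflexive (trans (↭-length perm′) (length-tabulate (w ∘ suc))))))
... | inj₂ perm    | inj₂ perm′ = inj₂ (↭-trans perm (prep (w zero) perm′))

nonzeros-fromList : ∀ {ms} → All (0 <_) ms → nonzeros (fromList ms) ≡ ms
nonzeros-fromList []                = refl
nonzeros-fromList {suc m ∷ _} (_ ∷ p) = cong (suc m ∷_) (nonzeros-fromList p)

-- The coefficient of x^μ, the monomial by which p_μ is detected.
_at_ : Series → Partition → ℚ
f at μ = f (length (parts μ)) (fromList (parts μ))

powerSumλ-count : ∀ μ r α → powerSumλ μ r α ≡
  ∑ (maps (length (parts μ)) r) (λ κ → ⟦ weightedContent (List.lookup (parts μ)) κ ≟ᵛ α ⟧)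
powerSumλ-count μ r α = trans
  (cong (λ ms → pProduct ms r α) (sym (tabulate-lookup (parts μ))))
  (pProduct-tabulate (List.lookup (parts μ)) r α)

powerSumλ-triangular : ∀ {μ ν} → length (parts ν) ≤ length (parts μ) → ν ≢ μ →
                       powerSumλ ν at μ ≡ 0ℚ
powerSumλ-triangular {μ} {ν} ν≤μ ν≢μ = trans (powerSumλ-count ν _ _)
  (∑-zero (maps (length (parts ν)) _) (λ κ → ⟦⟧-false (_ ≟ᵛ _) (absurd κ)))
  where
  absurd : ∀ κ → weightedContent (List.lookup (parts ν)) κ ≢ fromList (parts μ)
  absurd κ eq with nonzeros-weightedContent (List.lookup (parts ν)) κ
  ... | inj₁ short rewrite eq | nonzeros-fromList (positive-parts μ) = ℕ.<⇒≱ short ν≤μ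
  ... | inj₂ perm  rewrite eq | nonzeros-fromList (positive-parts μ) | tabulate-lookup (parts ν) =
    ν≢μ (partition-↭ (↭-sym perm))

∈-maps : ∀ (κ : Vec (Fin r) n) → κ ∈ maps n r
∈-maps []      = here refl
∈-maps (i ∷ κ) = ∈-cartesianProductWith⁺ _∷_ (∈-allFin i) (∈-maps κ)

weightedContent-map-suc : ∀ (w : Fin n → ℕ) (κ : Vec (Fin r) n) →
  weightedContent w (Vec.map suc κ) ≡ 0 ∷ weightedContent w κ
weightedContent-map-suc w [] = refl
weightedContent-map-suc w (i ∷ κ) =
  cong (single (suc i) (w zero) ⊕_) (weightedContent-map-suc (w ∘ suc) κ)

-- The witness is the identity colouring, built by shifting the colours of the tail up by one.
weightedContent-surjective : ∀ ms →
  ∃[ κ ] weightedContent (List.lookup ms) κ ≡ fromList ms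
weightedContent-surjective [] = [] , refl
weightedContent-surjective (m ∷ ms) with weightedContent-surjective ms
... | κ , eq = zero ∷ Vec.map suc κ , (begin
  single zero m ⊕ weightedContent (List.lookup ms) (Vec.map suc κ)
    ≡⟨ cong (single zero m ⊕_) (weightedContent-map-suc (List.lookup ms) κ) ⟩
  m ℕ.+ 0 ∷ Vec.replicate _ 0 ⊕ weightedContent (List.lookup ms) κ
    ≡⟨ cong₂ _∷_ (ℕ.+-identityʳ m) (trans (⊕-identityˡ _) eq) ⟩
  m ∷ fromList ms ∎)

∑-⟦⟧≢0 : ∀ {A : Set} {P : A → Set} (P? : ∀ x → Dec (P x)) {xs x} →
         x ∈ xs → P x → ∑ xs (λ x → ⟦ P? x ⟧) ≢ 0ℚ
∑-⟦⟧≢0 P? {xs} x∈xs px eq = ℕ.<⇒≢ (∈-length (∈-filter⁺ P? x∈xs px))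
  (sym (fromℕ≡0⇒≡0 (length (filter P? xs)) (trans (fromℕ-length-filter P? xs) eq)))

powerSumλ-diagonal : ∀ μ → powerSumλ μ at μ ≢ 0ℚ
powerSumλ-diagonal μ eq with weightedContent-surjective (parts μ)
... | κ , κ↦μ = ∑-⟦⟧≢0 (λ κ → weightedContent (List.lookup (parts μ)) κ ≟ᵛ fromList (parts μ))
  (∈-maps κ) κ↦μ (trans (sym (powerSumλ-count μ _ _)) eq)

∑-cong-∈ : ∀ (xs : List A) {f g : A → ℚ} → (∀ {x} → x ∈ xs → f x ≡ g x) → ∑ xs f ≡ ∑ xs g
∑-cong-∈ xs f≗g = cong sumℚ (map-cong-local (All.tabulate f≗g))

*-cancel-≢0 : ∀ {p q} → q ≢ 0ℚ → p ℚ.* q ≡ 0ℚ → p ≡ 0ℚ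
*-cancel-≢0 {p} {q} q≢0 pq≡0 = begin
  p                        ≡⟨ ℚ.*-identityʳ p ⟨
  p ℚ.* 1ℚ                 ≡⟨ cong (p ℚ.*_) (ℚ.*-inverseʳ q) ⟨
  p ℚ.* (q ℚ.* (ℚ.1/ q))   ≡⟨ ℚ.*-assoc p q _ ⟨
  p ℚ.* q ℚ.* (ℚ.1/ q)     ≡⟨ cong (ℚ._* (ℚ.1/ q)) pq≡0 ⟩
  0ℚ ℚ.* (ℚ.1/ q)          ≡⟨ ℚ.*-zeroˡ (ℚ.1/ q) ⟩
  0ℚ                       ∎
  where instance
    q≠0 : ℚ.NonZero q
    q≠0 = ℚ.≢-nonZero q≢0

-- Formal linear combinations, in which partitions may repeat.
Combination : Set
Combination = List (ℚ × Partition)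

evaluate : Combination → Series
evaluate T r α = ∑ T (λ (a , μ) → a ℚ.* powerSumλ μ r α)

collect : Combination → Partition → ℚ
collect T μ = ∑ T (λ (a , ν) → a ℚ.* ⟦ ν ≟ᴾ μ ⟧)

collect-vanishes : ∀ T {μ} → μ ∉ map proj₂ T → collect T μ ≡ 0ℚ
collect-vanishes []             μ∉ = refl
collect-vanishes ((a , ν) ∷ T) {μ} μ∉ = cong₂ ℚ._+_
  (trans (cong (a ℚ.*_) (⟦⟧-false (ν ≟ᴾ μ) (μ∉ ∘ here ∘ sym))) (ℚ.*-zeroʳ a))
  (collect-vanishes T (μ∉ ∘ there))

-- Grouping equal partitions changes no linear functional of the combination. After the sums are
-- exchanged, only `μ = ν` survives in the sum over `U`.
∑-collect : ∀ T {U} (h : Partition → ℚ) → Unique U → (∀ {ν} → ν ∈ map proj₂ T → ν ∈ U) →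
            ∑ U (λ μ → collect T μ ℚ.* h μ) ≡ ∑ T (λ (a , ν) → a ℚ.* h ν)
∑-collect T {U} h unique T⊆U = begin
  ∑ U (λ μ → collect T μ ℚ.* h μ)
    ≡⟨ ∑-cong U (λ μ → sym (∑-*ʳ (h μ) T (λ (a , ν) → a ℚ.* ⟦ ν ≟ᴾ μ ⟧))) ⟩
  ∑ U (λ μ → ∑ T (λ (a , ν) → a ℚ.* ⟦ ν ≟ᴾ μ ⟧ ℚ.* h μ))
    ≡⟨ ∑-swap U T _ ⟩
  ∑ T (λ (a , ν) → ∑ U (λ μ → a ℚ.* ⟦ ν ≟ᴾ μ ⟧ ℚ.* h μ))
    ≡⟨ ∑-cong-∈ T (λ { {a , ν} aν∈T → trans
         (∑-cong U (λ μ → trans (ℚ.*-assoc a _ _)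
           (cong (λ q → a ℚ.* (q ℚ.* h μ)) (⟦⟧-cong (ν ≟ᴾ μ) (μ ≟ᴾ ν) sym sym))))
         (trans (∑-*ˡ a U (λ μ → ⟦ μ ≟ᴾ ν ⟧ ℚ.* h μ))
           (cong (a ℚ.*_) (∑-δ _≟ᴾ_ h unique (T⊆U (∈-map⁺ proj₂ aν∈T))))) }) ⟩
  ∑ T (λ (a , ν) → a ℚ.* h ν) ∎

infixl 6 _⊖_
_⊖_ : Combination → Combination → Combination
S ⊖ T = S ++ map (map₁ (λ a → ℚ.- a)) T

-- The function `h` is arbitrary so as to serve twice: with values of `powerSumλ` for evaluation,
-- and with an indicator for `collect`.
∑-⊖ : ∀ S T (h : Partition → ℚ) → ∑ (S ⊖ T) (λ (a , μ) → a ℚ.* h μ) ≡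
      ∑ S (λ (a , μ) → a ℚ.* h μ) ℚ.- ∑ T (λ (a , μ) → a ℚ.* h μ)
∑-⊖ S T h = trans (∑-++ S (map (map₁ (λ a → ℚ.- a)) T) f) (cong (∑ S f ℚ.+_)
  (trans (∑-map (map₁ (λ a → ℚ.- a)) T f)
    (trans (∑-cong T (λ (a , μ) → sym (ℚ.neg-distribˡ-* a (h μ)))) (∑-neg T f))))
  where
  f : ℚ × Partition → ℚ
  f (a , μ) = a ℚ.* h μ

collect-expansion : ∀ {f} T → f ≈ evaluate T → PowerSumExpansion f (collect T)
collect-expansion T f≈T = record
  { support   = deduplicate _≟ᴾ_ (map proj₂ T)
  ; unique    = DecUnique.deduplicate-! _≟ᴾ_ (map proj₂ T)
  ; vanishes  = λ μ μ∉ → collect-vanishes T (μ∉ ∘ ∈-deduplicate⁺ _≟ᴾ_)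
  ; expansion = λ r α → trans (f≈T r α) (sym
      (∑-collect T (λ μ → powerSumλ μ r α) (DecUnique.deduplicate-! _≟ᴾ_ (map proj₂ T)) (∈-deduplicate⁺ _≟ᴾ_)))
  }

-- Downward induction on the number of parts: in the coefficient of x^μ, the
-- power sums with more parts than μ are killed by their coefficients and the
-- others, except p_μ, do not contribute.
powerSums-independent : ∀ {c} → PowerSumExpansion (λ _ _ → 0ℚ) c → ∀ μ → c μ ≡ 0ℚ
powerSums-independent {c} E μ = descend bound μ (ℕ.m≤m+n bound (#parts μ))
  where
  open PowerSumExpansion E

  #parts : Partition → ℕ
  #parts ν = length (parts ν)

  -- One more than the largest number of parts in the support, so a partition reached with `d = 0`
  -- lies outside the support. Each unit of `d` pays for at least one additional part.
  bound : ℕ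
  bound = suc (max 0 (map #parts support))

  descend : ∀ d μ → bound ≤ d ℕ.+ #parts μ → c μ ≡ 0ℚ
  descend zero μ b≤ = vanishes μ (λ μ∈ → ℕ.<⇒≱ b≤
    (All.lookup (xs≤max 0 (map #parts support)) (∈-map⁺ #parts μ∈)))
  descend (suc d) μ b≤ with DecMembership._∈?_ _≟ᴾ_ μ support
  ... | no μ∉  = vanishes μ μ∉
  ... | yes μ∈ = *-cancel-≢0 (powerSumλ-diagonal μ) (begin
    h μ
      ≡⟨ ∑-δ _≟ᴾ_ h unique μ∈ ⟨
    ∑ support (λ ν → ⟦ ν ≟ᴾ μ ⟧ ℚ.* h ν)
      ≡⟨ ∑-cong support (λ ν → ⟦⟧-absorb (ν ≟ᴾ μ) (h≡0 ν)) ⟩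
    ∑ support h
      ≡⟨ expansion _ _ ⟨
    0ℚ ∎)
    where
    h : Partition → ℚ
    h ν = c ν ℚ.* powerSumλ ν at μ

    h≡0 : ∀ ν → ν ≢ μ → h ν ≡ 0ℚ
    h≡0 ν ν≢μ with #parts ν ℕ.≤? #parts μ
    ... | yes ν≤μ = trans (cong (c ν ℚ.*_) (powerSumλ-triangular ν≤μ ν≢μ)) (ℚ.*-zeroʳ (c ν))
    ... | no ν≰μ  = trans
      (cong (ℚ._* powerSumλ ν at μ) (descend d ν
        (ℕ.≤-trans b≤ (ℕ.≤-trans (ℕ.≤-reflexive (sym (ℕ.+-suc d (#parts μ))))
          (ℕ.+-monoʳ-≤ d (ℕ.≰⇒> ν≰μ))))))
      (ℚ.*-zeroˡ (powerSumλ ν at μ))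

-- Presents a single coefficient as a linear functional of the expansion, so that it can be
-- subtracted in the same way as the series.
∑-support-⟦⟧ : ∀ {f c} (E : PowerSumExpansion f c) μ →
  ∑ (PowerSumExpansion.support E) (λ ν → c ν ℚ.* ⟦ ν ≟ᴾ μ ⟧) ≡ c μ
∑-support-⟦⟧ {c = c} E μ = trans
  (∑-cong support (λ ν → ℚ.*-comm (c ν) ⟦ ν ≟ᴾ μ ⟧)) select
  where
  open PowerSumExpansion E
  select : ∑ support (λ ν → ⟦ ν ≟ᴾ μ ⟧ ℚ.* c ν) ≡ c μ
  select with DecMembership._∈?_ _≟ᴾ_ μ support
  ... | yes μ∈ = ∑-δ _≟ᴾ_ c unique μ∈
  ... | no μ∉  = trans (∑-δ-∉ _≟ᴾ_ c μ∉) (sym (vanishes μ μ∉))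

-- The difference of two expansions represents 0. Since their supports may overlap, it is formed as
-- a combination with repetitions and then collected.
expansion-unique : ∀ {f c d} → PowerSumExpansion f c → PowerSumExpansion f d → ∀ μ → c μ ≡ d μ
expansion-unique {f} {c} {d} C D μ = x∙y⁻¹≈ε⇒x≈y ℚ.+-0-group (c μ) (d μ) (begin
  c μ ℚ.- d μ
    ≡⟨ cong₂ ℚ._-_ (∑-support-⟦⟧ C μ) (∑-support-⟦⟧ D μ) ⟨
  _
    ≡⟨ ∑-difference (λ ν → ⟦ ν ≟ᴾ μ ⟧) ⟨
  collect T μ
    ≡⟨ powerSums-independent (collect-expansion T (λ r α → sym (begin
         evaluate T r α
           ≡⟨ ∑-difference (λ ν → powerSumλ ν r α) ⟩
         _
           ≡⟨ cong₂ ℚ._-_ (C.expansion r α) (D.expansion r α) ⟨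
         f r α ℚ.- f r α
           ≡⟨ ℚ.+-inverseʳ (f r α) ⟩
         0ℚ ∎))) μ ⟩
  0ℚ ∎)
  where
  module C = PowerSumExpansion C
  module D = PowerSumExpansion D

  pairs : (Partition → ℚ) → List Partition → Combination
  pairs c = map (λ ν → c ν , ν)

  T : Combination
  T = pairs c C.support ⊖ pairs d D.support

  ∑-difference : ∀ (h : Partition → ℚ) → ∑ T (λ (a , ν) → a ℚ.* h ν) ≡
    ∑ C.support (λ ν → c ν ℚ.* h ν) ℚ.- ∑ D.support (λ ν → d ν ℚ.* h ν)
  ∑-difference h = trans (∑-⊖ (pairs c C.support) (pairs d D.support) h)
    (cong₂ ℚ._-_ (∑-map (λ ν → c ν , ν) C.support _) (∑-map (λ ν → d ν , ν) D.support _))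

-- Deletion and contraction

-- The quotient map of a contraction: the index `u` disappears, and the index of `v` stands for the
-- merged block.
identify : {u v : Fin (suc ℓ)} → u ≢ v → Fin (suc ℓ) → Fin ℓ
identify {u = u} u≢v x with u Fin.≟ x
... | yes _  = punchOut u≢v
... | no u≢x = punchOut u≢x

mergeWeights : {u v : Fin (suc ℓ)} → u ≢ v → (Fin (suc ℓ) → ℕ) → Fin ℓ → ℕ
mergeWeights {u = u} u≢v w = F.updateAt (w ∘ punchIn u) (punchOut u≢v) (w u ℕ.+_)

mergeWeights-merged : ∀ {u v : Fin (suc ℓ)} (u≢v : u ≢ v) w →
  mergeWeights u≢v w (punchOut u≢v) ≡ w u ℕ.+ w v
mergeWeights-merged {u = u} u≢v w = trans
  (F.updateAt-updates (punchOut u≢v) (w ∘ punchIn u)) (cong (λ i → w u ℕ.+ w i) (Fin.punchIn-punchOut u≢v))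

mergeWeights-≥ : ∀ {u v : Fin (suc ℓ)} (u≢v : u ≢ v) w i →
  w (punchIn u i) ≤ mergeWeights u≢v w i
mergeWeights-≥ {u = u} u≢v w i with i Fin.≟ punchOut u≢v
... | yes refl = ℕ.≤-trans (ℕ.m≤n+m _ (w u)) (ℕ.≤-reflexive (sym (F.updateAt-updates i (w ∘ punchIn u))))
... | no i≢v   = ℕ.≤-reflexive (sym (F.updateAt-minimal i _ (w ∘ punchIn u) i≢v))

mergeWeights-positive : ∀ {u v : Fin (suc ℓ)} (u≢v : u ≢ v) {w} →
  (∀ i → 0 < w i) → ∀ i → 0 < mergeWeights u≢v w i
mergeWeights-positive {u = u} u≢v {w} w>0 i = ℕ.≤-trans (w>0 (punchIn u i)) (mergeWeights-≥ u≢v w i)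

weightedContent-insertAt : ∀ (w : Fin (suc ℓ) → ℕ) (κ : Vec (Fin r) ℓ) u c →
  weightedContent w (insertAt κ u c) ≡ single c (w u) ⊕ weightedContent (w ∘ punchIn u) κ
weightedContent-insertAt w κ       zero    c = refl
weightedContent-insertAt w (i ∷ κ) (suc u) c = trans
  (cong (single i (w zero) ⊕_) (weightedContent-insertAt (w ∘ suc) κ u c))
  (⊕-exchange (single i (w zero)) (single c (w (suc u))) _)

single-+ : ∀ (i : Fin r) a b → single i (a ℕ.+ b) ≡ single i a ⊕ single i b
single-+ zero    a b = cong (a ℕ.+ b ∷_) (sym (⊕-identityˡ _))
single-+ (suc i) a b = cong (0 ∷_) (single-+ i a b)

weightedContent-updateAt : ∀ (w : Fin ℓ → ℕ) (κ : Vec (Fin r) ℓ) v m →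
  weightedContent (F.updateAt w v (m ℕ.+_)) κ ≡ single (lookup κ v) m ⊕ weightedContent w κ
weightedContent-updateAt w (i ∷ κ) zero m = trans
  (cong (_⊕ weightedContent (w ∘ suc) κ) (single-+ i m (w zero))) (⊕-assoc (single i m) _ _)
weightedContent-updateAt w (i ∷ κ) (suc v) m = trans
  (cong (single i (w zero) ⊕_) (weightedContent-updateAt (w ∘ suc) κ v m))
  (⊕-exchange (single i (w zero)) (single (lookup κ v) m) _)

extend : {u v : Fin (suc ℓ)} → u ≢ v → Vec (Fin r) ℓ → Vec (Fin r) (suc ℓ)
extend {u = u} u≢v κ = insertAt κ u (lookup κ (punchOut u≢v))

lookup-insertAt-≢ : ∀ {A : Set} (xs : Vec A ℓ) {u x} (u≢x : u ≢ x) c →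
  lookup (insertAt xs u c) x ≡ lookup xs (punchOut u≢x)
lookup-insertAt-≢ xs {u} u≢x c = trans
  (cong (lookup (insertAt xs u c)) (sym (Fin.punchIn-punchOut u≢x)))
  (Vec.insertAt-punchIn xs u c (punchOut u≢x))

lookup-extend : ∀ {u v : Fin (suc ℓ)} (u≢v : u ≢ v) (κ : Vec (Fin r) ℓ) x →
  lookup (extend u≢v κ) x ≡ lookup κ (identify u≢v x)
lookup-extend {u = u} u≢v κ x with u Fin.≟ x
... | yes refl = Vec.insertAt-lookup κ u _
... | no u≢x   = lookup-insertAt-≢ κ u≢x _

weightedContent-extend : ∀ {u v : Fin (suc ℓ)} (u≢v : u ≢ v) w (κ : Vec (Fin r) ℓ) →
  weightedContent w (extend u≢v κ) ≡ weightedContent (mergeWeights u≢v w) κ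
weightedContent-extend {u = u} u≢v w κ = trans (weightedContent-insertAt w κ u _)
  (sym (weightedContent-updateAt (w ∘ punchIn u) κ (punchOut u≢v) (w u)))

∑-maps-insertAt : ∀ (u : Fin (suc ℓ)) (f : Vec (Fin r) (suc ℓ) → ℚ) →
  ∑ (maps (suc ℓ) r) f ≡ ∑ (maps ℓ r) (λ κ → ∑ (allFin r) (λ c → f (insertAt κ u c)))
∑-maps-insertAt {ℓ} {r} zero f = trans
  (∑-product _∷_ (allFin r) (maps ℓ r) f) (∑-swap (allFin r) (maps ℓ r) _)
∑-maps-insertAt {suc ℓ} {r} (suc u) f = trans
  (∑-product _∷_ (allFin r) (maps (suc ℓ) r) f)
  (trans (∑-cong (allFin r) (λ i → ∑-maps-insertAt u (λ κ → f (i ∷ κ))))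
    (sym (∑-product _∷_ (allFin r) (maps ℓ r) (λ κ → ∑ (allFin r) (λ c → f (insertAt κ (suc u) c))))))

-- A colouring that agrees at `u` and `v` is determined by its values away from `u`, that is, by a
-- colouring of the contraction. Summing over the colour of `u` separately leaves the one value
-- dictated by `v`.
∑-maps-identified : ∀ {u v : Fin (suc ℓ)} (u≢v : u ≢ v) (f : Vec (Fin r) (suc ℓ) → ℚ) →
  ∑ (maps (suc ℓ) r) (λ κ → ⟦ lookup κ u Fin.≟ lookup κ v ⟧ ℚ.* f κ) ≡
  ∑ (maps ℓ r) (λ κ → f (extend u≢v κ))
∑-maps-identified {ℓ} {r} {u} {v} u≢v f = trans (∑-maps-insertAt u _)
  (∑-cong (maps ℓ r) (λ κ → trans
    (∑-cong (allFin r) (λ c → cong₂ (λ i j → ⟦ i Fin.≟ j ⟧ ℚ.* f (insertAt κ u c))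
      (Vec.insertAt-lookup κ u c) (lookup-insertAt-≢ κ u≢v c)))
    (∑-δ Fin._≟_ (λ c → f (insertAt κ u c)) (Unique.allFin⁺ r) (∈-allFin (lookup κ (punchOut u≢v))))))

-- A product of factors 1 - δ instead of one indicator, so that a single edge can be expanded
-- linearly.
properOn : List (Fin n × Fin n) → (Fin n → Fin r) → ℚ
properOn []             κ = 1ℚ
properOn ((x , y) ∷ es) κ = (1ℚ ℚ.- ⟦ κ x Fin.≟ κ y ⟧) ℚ.* properOn es κ

properOn-cong : ∀ (es : List (Fin n × Fin n)) {κ κ′ : Fin n → Fin r} → (∀ x → κ x ≡ κ′ x) →
                properOn es κ ≡ properOn es κ′
properOn-cong []             κ≗κ′ = refl
properOn-cong ((x , y) ∷ es) κ≗κ′ = cong₂ ℚ._*_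
  (cong₂ (λ i j → 1ℚ ℚ.- ⟦ i Fin.≟ j ⟧) (κ≗κ′ x) (κ≗κ′ y)) (properOn-cong es κ≗κ′)

-- The chromatic series of the multigraph with vertices Fin ℓ of weights w and
-- edges {π x , π y} for (x , y) in es.
weightedChromatic : (Fin ℓ → ℕ) → (Fin n → Fin ℓ) → List (Fin n × Fin n) → Series
weightedChromatic {ℓ} w π es r α =
  ∑ (maps ℓ r) (λ κ → properOn es (lookup κ ∘ π) ℚ.* ⟦ weightedContent w κ ≟ᵛ α ⟧)

weightedChromatic-loop : ∀ (w : Fin ℓ → ℕ) (π : Fin n → Fin ℓ) {x y} es → π x ≡ π y →
  ∀ r α → weightedChromatic w π ((x , y) ∷ es) r α ≡ 0ℚ
weightedChromatic-loop {ℓ} w π {x} {y} es πx≡πy r α = ∑-zero (maps ℓ r) (λ κ → trans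
  (cong (λ q → (1ℚ ℚ.- q) ℚ.* properOn es (lookup κ ∘ π) ℚ.* ⟦ weightedContent w κ ≟ᵛ α ⟧)
    (⟦⟧-true (lookup κ (π x) Fin.≟ lookup κ (π y)) (cong (lookup κ) πx≡πy)))
  (trans (cong (ℚ._* ⟦ weightedContent w κ ≟ᵛ α ⟧) (ℚ.*-zeroˡ (properOn es (lookup κ ∘ π))))
    (ℚ.*-zeroˡ ⟦ weightedContent w κ ≟ᵛ α ⟧)))

-- In the factor 1 - δ of the first edge, the 1 deletes the edge and the δ keeps the colourings
-- constant on it, which are those of the contraction.
deletion-contraction : ∀ (w : Fin (suc ℓ) → ℕ) (π : Fin n → Fin (suc ℓ)) {x y} es
  (u≢v : π x ≢ π y) r α →
  weightedChromatic w π ((x , y) ∷ es) r α ≡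
  weightedChromatic w π es r α ℚ.- weightedChromatic (mergeWeights u≢v w) (identify u≢v ∘ π) es r α
deletion-contraction {ℓ} w π {x} {y} es u≢v r α = begin
  ∑ (maps (suc ℓ) r) (λ κ → (1ℚ ℚ.- δ κ) ℚ.* properOn es (lookup κ ∘ π) ℚ.* ⟦ weightedContent w κ ≟ᵛ α ⟧)
    ≡⟨ ∑-cong (maps (suc ℓ) r) (λ κ → expand (δ κ) _ _) ⟩
  ∑ (maps (suc ℓ) r) (λ κ → f κ ℚ.+ (ℚ.- (δ κ ℚ.* f κ)))
    ≡⟨ ∑-+ (maps (suc ℓ) r) f (λ κ → ℚ.- (δ κ ℚ.* f κ)) ⟩
  ∑ (maps (suc ℓ) r) f ℚ.+ ∑ (maps (suc ℓ) r) (λ κ → ℚ.- (δ κ ℚ.* f κ))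
    ≡⟨ cong (∑ (maps (suc ℓ) r) f ℚ.+_) (∑-neg (maps (suc ℓ) r) (λ κ → δ κ ℚ.* f κ)) ⟩
  ∑ (maps (suc ℓ) r) f ℚ.- ∑ (maps (suc ℓ) r) (λ κ → δ κ ℚ.* f κ)
    ≡⟨ cong (λ q → ∑ (maps (suc ℓ) r) f ℚ.- q) (trans (∑-maps-identified u≢v f)
         (∑-cong (maps ℓ r) (λ κ → cong₂ (λ p β → p ℚ.* ⟦ β ≟ᵛ α ⟧)
           (properOn-cong es (λ z → lookup-extend u≢v κ (π z)))
           (weightedContent-extend u≢v w κ)))) ⟩
  _ ∎
  where
  δ f : Vec (Fin r) (suc ℓ) → ℚ
  δ κ = ⟦ lookup κ (π x) Fin.≟ lookup κ (π y) ⟧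
  f κ = properOn es (lookup κ ∘ π) ℚ.* ⟦ weightedContent w κ ≟ᵛ α ⟧

  expand : ∀ d p i → (1ℚ ℚ.- d) ℚ.* p ℚ.* i ≡ p ℚ.* i ℚ.+ (ℚ.- (d ℚ.* (p ℚ.* i)))
  expand = solve 3 (λ d p i → (con 1ℚ :- d) :* p :* i := p :* i :+ (:- (d :* (p :* i)))) refl
    where open +-*-Solver

open Sort ≥-decTotalOrder using (sort; sort-↭; sort-↗)

sortedPartition : (ms : List ℕ) → All (0 <_) ms → Partition
sortedPartition ms ms>0 =
  mkPartition (sort ms) (sort-↗ ms) (All-resp-↭ (↭-sym (sort-↭ ms)) ms>0)

blockSizes : (w : Fin ℓ → ℕ) → (∀ i → 0 < w i) → Partition
blockSizes w w>0 = sortedPartition (tabulate w) (All.tabulate⁺ w>0)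

terms : (w : Fin ℓ → ℕ) → (∀ i → 0 < w i) → (Fin n → Fin ℓ) → List (Fin n × Fin n) → Combination
terms w w>0 π [] = (1ℚ , blockSizes w w>0) ∷ []
-- Impossible, as `π x` would lie in `Fin 0`; the case only exposes the `suc ℓ` that contraction
-- requires.
terms {zero}  w w>0 π ((x , y) ∷ es) = []
terms {suc ℓ} w w>0 π ((x , y) ∷ es) with π x Fin.≟ π y
... | yes _  = []
... | no u≢v = terms w w>0 π es ⊖
  terms (mergeWeights u≢v w) (mergeWeights-positive u≢v w>0) (identify u≢v ∘ π) es

weightedChromatic-terms : ∀ (w : Fin ℓ → ℕ) w>0 (π : Fin n → Fin ℓ) es →
  weightedChromatic w π es ≈ evaluate (terms w w>0 π es)
weightedChromatic-terms {ℓ} w w>0 π [] r α = begin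
  ∑ (maps ℓ r) (λ κ → 1ℚ ℚ.* ⟦ weightedContent w κ ≟ᵛ α ⟧)
    ≡⟨ ∑-*ˡ 1ℚ (maps ℓ r) (λ κ → ⟦ weightedContent w κ ≟ᵛ α ⟧) ⟩
  1ℚ ℚ.* ∑ (maps ℓ r) (λ κ → ⟦ weightedContent w κ ≟ᵛ α ⟧)
    ≡⟨ cong (1ℚ ℚ.*_) (trans (sym (pProduct-tabulate w r α)) (pProduct-↭ (↭-sym (sort-↭ (tabulate w))) r α)) ⟩
  1ℚ ℚ.* powerSumλ (blockSizes w w>0) r α
    ≡⟨ ℚ.+-identityʳ _ ⟨
  evaluate (terms w w>0 π []) r α ∎
weightedChromatic-terms {zero} w w>0 π ((x , y) ∷ es) r α with () ← π x
weightedChromatic-terms {suc ℓ} w w>0 π ((x , y) ∷ es) r α with π x Fin.≟ π y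
... | yes πx≡πy = weightedChromatic-loop w π es πx≡πy r α
... | no u≢v    = trans (deletion-contraction w π es u≢v r α) (trans
  (cong₂ ℚ._-_ (weightedChromatic-terms w w>0 π es r α)
    (weightedChromatic-terms (mergeWeights u≢v w) (mergeWeights-positive u≢v w>0) (identify u≢v ∘ π) es r α))
  (sym (∑-⊖ (terms w w>0 π es) _ (λ μ → powerSumλ μ r α))))

-- The chromatic symmetric function

length-filter-map : ∀ {A B : Set} {P : B → Set} (P? : ∀ y → Dec (P y)) (f : A → B) xs →
  length (filter P? (map f xs)) ≡ length (filter (P? ∘ f) xs)
length-filter-map P? f []       = refl
length-filter-map P? f (x ∷ xs) with P? (f x)
... | yes _ = cong suc (length-filter-map P? f xs)
... | no _  = length-filter-map P? f xs

lookup-weightedContent : ∀ (κ : Vec (Fin r) n) i →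
  lookup (weightedContent (λ _ → 1) κ) i ≡ length (filter (λ v → lookup κ v Fin.≟ i) (allFin n))
lookup-weightedContent {r} [] i = Vec.lookup-replicate i 0
lookup-weightedContent {r} {suc n} (j ∷ κ) i = trans
  (Vec.lookup-zipWith ℕ._+_ i (single j 1) (weightedContent (λ _ → 1) κ))
  (trans (cong (lookup (single j 1) i ℕ.+_) (trans (lookup-weightedContent κ i) tail-count)) head-count)
  where
  P? : ∀ v → Dec (lookup (j ∷ κ) v ≡ i)
  P? v = lookup (j ∷ κ) v Fin.≟ i

  tail-count : length (filter (P? ∘ suc) (allFin n)) ≡ length (filter P? (tabulate suc))
  tail-count = trans (sym (length-filter-map P? suc (allFin n)))
    (cong (λ vs → length (filter P? vs)) (map-tabulate id suc))

  head-count : lookup (single j 1) i ℕ.+ length (filter P? (tabulate suc)) ≡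
               length (filter P? (allFin (suc n)))
  head-count with j Fin.≟ i
  ... | yes refl = cong (ℕ._+ length (filter P? (tabulate suc))) (Vec.lookup∘updateAt j (Vec.replicate r 0))
  ... | no j≢i   = cong (ℕ._+ length (filter P? (tabulate suc))) (trans
    (Vec.lookup∘updateAt′ i j (j≢i ∘ sym) (Vec.replicate r 0)) (Vec.lookup-replicate i 0))

content≡weightedContent : ∀ (κ : Vec (Fin r) n) → content (lookup κ) ≡ weightedContent (λ _ → 1) κ
content≡weightedContent κ = trans
  (Vec.tabulate-cong (λ i → sym (lookup-weightedContent κ i))) (Vec.tabulate∘lookup _)

properOn-⟦⟧ : ∀ (es : List (Fin n × Fin n)) (κ : Fin n → Fin r) →
  properOn es κ ≡ ⟦ All.all? (λ (x , y) → ¬? (κ x Fin.≟ κ y)) es ⟧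
properOn-⟦⟧ []             κ = refl
properOn-⟦⟧ ((x , y) ∷ es) κ with κ x Fin.≟ κ y
... | yes _ = ℚ.*-zeroˡ (properOn es κ)
... | no _  = trans (ℚ.*-identityˡ (properOn es κ)) (properOn-⟦⟧ es κ)

module _ (G : Graph n) where

  edge? : ∀ (e : Fin n × Fin n) → Dec (proj₁ e Fin.< proj₂ e × Adj G (proj₁ e) (proj₂ e))
  edge? (u , v) = (u Fin.<? v) ×-dec adj? G u v

  ∈-edges⁺ : ∀ {u v} → u Fin.< v → Adj G u v → (u , v) ∈ edges G
  ∈-edges⁺ {u} {v} u<v uv =
    ∈-filter⁺ edge? (∈-cartesianProduct⁺ (∈-allFin u) (∈-allFin v)) (u<v , uv)

  ∈-edges⁻ : ∀ {u v} → (u , v) ∈ edges G → u Fin.< v × Adj G u v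
  ∈-edges⁻ uv∈ = proj₂ (∈-filter⁻ edge? {xs = cartesianProduct (allFin n) (allFin n)} uv∈)

  ⟦proper⟧≡properOn-edges : ∀ (κ : Fin n → Fin r) → ⟦ proper? G κ ⟧ ≡ properOn (edges G) κ
  ⟦proper⟧≡properOn-edges κ = trans
    (⟦⟧-cong (proper? G κ) (All.all? (λ (x , y) → ¬? (κ x Fin.≟ κ y)) (edges G)) onEdges fromEdges)
    (sym (properOn-⟦⟧ (edges G) κ))
    where
    onEdges : Proper G κ → All (λ (x , y) → κ x ≢ κ y) (edges G)
    onEdges proper = All.tabulate (λ { {u , v} uv∈ → proper u v (proj₂ (∈-edges⁻ uv∈)) })

    fromEdges : All (λ (x , y) → κ x ≢ κ y) (edges G) → Proper G κ
    fromEdges all u v uv with Fin.<-cmp u v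
    ... | tri< u<v _ _  = All.lookup all (∈-edges⁺ u<v uv)
    ... | tri≈ _ u≡v _  = contradiction uv (irrefl G u≡v)
    ... | tri> _ _ v<u  = All.lookup all (∈-edges⁺ v<u (Graph.sym G uv)) ∘ sym

  chromatic-⟦⟧ : ∀ r α → chromatic G r α ≡
    ∑ (maps n r) (λ κ → ⟦ proper? G (lookup κ) ×-dec (content (lookup κ) ≟ᵛ α) ⟧)
  chromatic-⟦⟧ r α =
    fromℕ-length-filter (λ κ → proper? G (lookup κ) ×-dec (content (lookup κ) ≟ᵛ α)) (maps n r)

  chromatic≈weightedChromatic : chromatic G ≈ weightedChromatic (λ _ → 1) id (edges G)
  chromatic≈weightedChromatic r α = trans (chromatic-⟦⟧ r α) (∑-cong (maps n r) (λ κ → trans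
    (⟦⟧-× (proper? G (lookup κ)) (content (lookup κ) ≟ᵛ α))
    (cong₂ ℚ._*_ (⟦proper⟧≡properOn-edges (lookup κ))
      (cong (λ β → ⟦ β ≟ᵛ α ⟧) (content≡weightedContent κ)))))

-- Homogeneity and the number of vertices

sum-⊕ : ∀ (α β : Vec ℕ r) → Vec.sum (α ⊕ β) ≡ Vec.sum α ℕ.+ Vec.sum β
sum-⊕ []      []      = refl
sum-⊕ (a ∷ α) (b ∷ β) = trans (cong (a ℕ.+ b ℕ.+_) (sum-⊕ α β))
  (interchange ℕ.+-commutativeSemigroup a b (Vec.sum α) (Vec.sum β))

sum-zeros : ∀ r → Vec.sum (Vec.replicate r 0) ≡ 0
sum-zeros zero    = refl
sum-zeros (suc r) = sum-zeros r

sum-single : ∀ (i : Fin r) m → Vec.sum (single i m) ≡ m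
sum-single {suc r} zero m = trans (cong (m ℕ.+_) (sum-zeros r)) (ℕ.+-identityʳ m)
sum-single (suc i) m = sum-single i m

sum-weightedContent : ∀ (κ : Vec (Fin r) n) → Vec.sum (weightedContent (λ _ → 1) κ) ≡ n
sum-weightedContent {r} [] = sum-zeros r
sum-weightedContent (i ∷ κ) = trans (sum-⊕ (single i 1) _)
  (cong₂ ℕ._+_ (sum-single i 1) (sum-weightedContent κ))

sum-content : ∀ (κ : Vec (Fin r) n) → Vec.sum (content (lookup κ)) ≡ n
sum-content κ = trans (cong Vec.sum (content≡weightedContent κ)) (sum-weightedContent κ)

-- An injective colouring of G is proper, so X_G ≠ 0, and X_G is homogeneous of
-- degree n.
chromatic-determines-order : ∀ {m} (G : Graph n) (H : Graph m) → chromatic G ≈ chromatic H → n ≡ m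
chromatic-determines-order {n} {m} G H G≈H = decidable-stable (n ℕ.≟ m) (λ n≢m →
  ∑-⟦⟧≢0 proper-content? (∈-maps κ₀) (proper , refl)
    (trans (sym (chromatic-⟦⟧ G n α)) (trans (G≈H n α) (H-vanishes n≢m))))
  where
  κ₀ : Vec (Fin n) n
  κ₀ = Vec.allFin n

  α : Vec ℕ n
  α = content (lookup κ₀)

  proper : Proper G (lookup κ₀)
  proper u v uv κu≡κv = irrefl G
    (trans (sym (Vec.lookup-allFin u)) (trans κu≡κv (Vec.lookup-allFin v))) uv

  proper-content? : ∀ (κ : Vec (Fin n) n) → Dec (Proper G (lookup κ) × content (lookup κ) ≡ α)
  proper-content? κ = proper? G (lookup κ) ×-dec (content (lookup κ) ≟ᵛ α)

  H-vanishes : n ≢ m → chromatic H n α ≡ 0ℚ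
  H-vanishes n≢m = trans (chromatic-⟦⟧ H n α) (∑-zero (maps m n) (λ κ →
    ⟦⟧-false (proper? H (lookup κ) ×-dec (content (lookup κ) ≟ᵛ α))
      (λ (_ , κ↦α) → n≢m (trans (sym (sum-content κ₀)) (trans (cong Vec.sum (sym κ↦α)) (sum-content κ))))))

-- Contractions of small blocks

identify-≢ : ∀ {u v x : Fin (suc ℓ)} (u≢v : u ≢ v) (u≢x : u ≢ x) → identify u≢v x ≡ punchOut u≢x
identify-≢ {u = u} {x = x} u≢v u≢x with u Fin.≟ x
... | yes u≡x = contradiction u≡x u≢x
... | no _    = Fin.punchOut-cong u refl

identify-≡ : ∀ {u v x y : Fin (suc ℓ)} (u≢v : u ≢ v) → identify u≢v x ≡ identify u≢v y →
             x ≡ y ⊎ (x ≡ u × y ≡ v) ⊎ (x ≡ v × y ≡ u)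
identify-≡ {u = u} {v} {x} {y} u≢v eq with u Fin.≟ x | u Fin.≟ y
... | yes refl | yes refl = inj₁ refl
... | yes refl | no u≢y   = inj₂ (inj₁ (refl , sym (Fin.punchOut-injective u≢v u≢y eq)))
... | no u≢x   | yes refl = inj₂ (inj₂ (Fin.punchOut-injective u≢x u≢v eq , refl))
... | no u≢x   | no u≢y   = inj₁ (Fin.punchOut-injective u≢x u≢y eq)

module _ {u v : Fin (suc ℓ)} (u≢v : u ≢ v) (w : Fin (suc ℓ) → ℕ) where

  mergeWeights-unmerged : ∀ {i} → i ≢ punchOut u≢v → mergeWeights u≢v w i ≡ w (punchIn u i)
  mergeWeights-unmerged {i} i≢v = F.updateAt-minimal i (punchOut u≢v) (w ∘ punchIn u) i≢v

  mergeWeights-identify-u : mergeWeights u≢v w (identify u≢v u) ≡ w u ℕ.+ w v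
  mergeWeights-identify-u with u Fin.≟ u
  ... | yes _  = mergeWeights-merged u≢v w
  ... | no u≢u = contradiction refl u≢u

  mergeWeights-identify-v : mergeWeights u≢v w (identify u≢v v) ≡ w u ℕ.+ w v
  mergeWeights-identify-v = trans (cong (mergeWeights u≢v w) (identify-≢ u≢v u≢v)) (mergeWeights-merged u≢v w)

  mergeWeights-identify : ∀ {x} → u ≢ x → v ≢ x → mergeWeights u≢v w (identify u≢v x) ≡ w x
  mergeWeights-identify {x} u≢x v≢x = begin
    mergeWeights u≢v w (identify u≢v x)
      ≡⟨ cong (mergeWeights u≢v w) (identify-≢ u≢v u≢x) ⟩
    mergeWeights u≢v w (punchOut u≢x)
      ≡⟨ mergeWeights-unmerged (λ eq → v≢x (Fin.punchOut-injective u≢v u≢x (sym eq))) ⟩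
    w (punchIn u (punchOut u≢x))
      ≡⟨ cong w (Fin.punchIn-punchOut u≢x) ⟩
    w x ∎

sum-punchIn : ∀ (w : Fin (suc ℓ) → ℕ) u → sum (tabulate w) ≡ w u ℕ.+ sum (tabulate (w ∘ punchIn u))
sum-punchIn w zero = refl
sum-punchIn {suc ℓ} w (suc u) = trans (cong (w zero ℕ.+_) (sum-punchIn (w ∘ suc) u))
  (x∙yz≈y∙xz ℕ.+-commutativeSemigroup (w zero) (w (suc u)) _)

sum-updateAt : ∀ (w : Fin ℓ → ℕ) v m → sum (tabulate (F.updateAt w v (m ℕ.+_))) ≡ m ℕ.+ sum (tabulate w)
sum-updateAt {suc ℓ} w zero    m = ℕ.+-assoc m (w zero) _
sum-updateAt {suc ℓ} w (suc v) m = trans (cong (w zero ℕ.+_) (sum-updateAt (w ∘ suc) v m))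
  (x∙yz≈y∙xz ℕ.+-commutativeSemigroup (w zero) m _)

sum-mergeWeights : ∀ {u v : Fin (suc ℓ)} (u≢v : u ≢ v) w →
  sum (tabulate (mergeWeights u≢v w)) ≡ sum (tabulate w)
sum-mergeWeights {u = u} u≢v w =
  trans (sum-updateAt (w ∘ punchIn u) (punchOut u≢v) (w u)) (sym (sum-punchIn w u))

-- The coefficient of p_{(2^k,1^j)}

twosOnes-≤2 : ∀ k j → All (_≤ 2) (parts (twosOnes k j))
twosOnes-≤2 k j = All.++⁺ (All.replicate⁺ k ℕ.≤-refl) (All.replicate⁺ j (s≤s z≤n))

↭-twosOnes : ∀ {ms} → All (0 <_) ms → All (_≤ 2) ms →
             ∃[ a ] ∃[ b ] ms ↭ parts (twosOnes a b)
↭-twosOnes [] [] = 0 , 0 , Perm.refl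
↭-twosOnes {m ∷ ms} (m>0 ∷ ms>0) (m≤2 ∷ ms≤2) with ↭-twosOnes ms>0 ms≤2
... | a , b , p with m
... | zero = contradiction m>0 λ ()
... | suc zero = a , suc b , ↭-trans (prep 1 p) (↭-sym (shift 1 (replicate a 2) (replicate b 1)))
... | suc (suc zero) = suc a , b , prep 2 p
... | suc (suc (suc _)) with s≤s (s≤s ()) ← m≤2

sum-twosOnes : ∀ a b → sum (parts (twosOnes a b)) ≡ a ℕ.+ (a ℕ.+ b)
sum-twosOnes zero    zero    = refl
sum-twosOnes zero    (suc b) = cong suc (sum-twosOnes zero b)
sum-twosOnes (suc a) b       = cong suc (trans (cong suc (sum-twosOnes a b)) (sym (ℕ.+-suc a (a ℕ.+ b))))

length-twosOnes : ∀ a b → length (parts (twosOnes a b)) ≡ a ℕ.+ b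
length-twosOnes a b = trans (length-++ (replicate a 2))
  (cong₂ ℕ._+_ (length-replicate a) (length-replicate b))

tabulate-↭-blockSizes : ∀ (w : Fin ℓ → ℕ) w>0 → tabulate w ↭ parts (blockSizes w w>0)
tabulate-↭-blockSizes w w>0 = ↭-sym (sort-↭ (tabulate w))

blockSizes≡twosOnes⇒ : ∀ {w : Fin ℓ → ℕ} {w>0 k} j → blockSizes w w>0 ≡ twosOnes k j → ℓ ≡ k ℕ.+ j
blockSizes≡twosOnes⇒ {ℓ} {w} {w>0} {k} j eq = begin
  ℓ                                ≡⟨ length-tabulate w ⟨
  length (tabulate w)              ≡⟨ ↭-length (tabulate-↭-blockSizes w w>0) ⟩
  length (parts (blockSizes w w>0)) ≡⟨ cong (length ∘ parts) eq ⟩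
  length (parts (twosOnes k j))    ≡⟨ length-twosOnes k j ⟩
  k ℕ.+ j                          ∎

-- With `a` twos and `b` ones, the number of parts is `a + b` and their sum is `a + (a + b)`; these
-- two numbers determine `a` and `b`.
⇒blockSizes≡twosOnes : ∀ {w : Fin ℓ → ℕ} {w>0 k j} → (∀ i → w i ≤ 2) →
  sum (tabulate w) ≡ k ℕ.+ (k ℕ.+ j) → ℓ ≡ k ℕ.+ j → blockSizes w w>0 ≡ twosOnes k j
⇒blockSizes≡twosOnes {ℓ} {w} {w>0} {k} {j} w≤2 sum≡ ℓ≡
  with a , b , p ← ↭-twosOnes (All.tabulate⁺ w>0) (All.tabulate⁺ w≤2) =
  partition-↭ (↭-trans (↭-sym (tabulate-↭-blockSizes w w>0))
    (subst₂ (λ a b → tabulate w ↭ parts (twosOnes a b)) a≡k b≡j p))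
  where
  a+b≡k+j : a ℕ.+ b ≡ k ℕ.+ j
  a+b≡k+j = trans (sym (length-twosOnes a b)) (trans (sym (↭-length p)) (trans (length-tabulate w) ℓ≡))

  a≡k : a ≡ k
  a≡k = ℕ.+-cancelʳ-≡ (k ℕ.+ j) a k (begin
    a ℕ.+ (k ℕ.+ j)             ≡⟨ cong (a ℕ.+_) a+b≡k+j ⟨
    a ℕ.+ (a ℕ.+ b)             ≡⟨ sum-twosOnes a b ⟨
    sum (parts (twosOnes a b))  ≡⟨ ℕ.sum-↭ p ⟨
    sum (tabulate w)            ≡⟨ sum≡ ⟩
    k ℕ.+ (k ℕ.+ j)             ∎)

  b≡j : b ≡ j
  b≡j = ℕ.+-cancelˡ-≡ k b j (trans (cong (ℕ._+ b) (sym a≡k)) a+b≡k+j)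

collect-heavy : ∀ {w : Fin ℓ → ℕ} w>0 (π : Fin n → Fin ℓ) es k j →
  ∃[ i ] 3 ≤ w i → collect (terms w w>0 π es) (twosOnes k j) ≡ 0ℚ
collect-heavy {w = w} w>0 π [] k j (i , wi≥3) =
  cong (λ q → 1ℚ ℚ.* q ℚ.+ 0ℚ) (⟦⟧-false (blockSizes w w>0 ≟ᴾ twosOnes k j) (λ eq →
    ℕ.<⇒≱ wi≥3 (All.tabulate⁻ (All-resp-↭ (↭-sym (tabulate-↭-blockSizes w w>0))
      (subst (All (_≤ 2) ∘ parts) (sym eq) (twosOnes-≤2 k j))) i)))
collect-heavy {zero} w>0 π (_ ∷ es) k j (() , _)
collect-heavy {suc ℓ} {w = w} w>0 π ((x , y) ∷ es) k j (i , wi≥3) with π x Fin.≟ π y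
... | yes _  = refl
... | no u≢v = trans (∑-⊖ (terms w w>0 π es) _ (λ μ → ⟦ μ ≟ᴾ twosOnes k j ⟧))
  (cong₂ ℚ._-_ (collect-heavy w>0 π es k j (i , wi≥3))
    (collect-heavy (mergeWeights-positive u≢v w>0) (identify u≢v ∘ π) es k j merged))
  where
  -- The heavy block is followed through the renumbering: if its own index is removed, the merged
  -- block inherits its weight.
  merged : ∃[ i′ ] 3 ≤ mergeWeights u≢v w i′
  merged with π x Fin.≟ i
  ... | yes refl = punchOut u≢v , ℕ.≤-trans wi≥3
    (ℕ.≤-trans (ℕ.m≤m+n (w i) (w (π y))) (ℕ.≤-reflexive (sym (mergeWeights-merged u≢v w))))
  ... | no u≢i   = punchOut u≢i , ℕ.≤-trans wi≥3
    (ℕ.≤-trans (ℕ.≤-reflexive (cong w (sym (Fin.punchIn-punchOut u≢i)))) (mergeWeights-≥ u≢v w _))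

-- Signed matchings along the recursion

sign : ℕ → ℚ
sign m = fromℤ (-1ℤ ℤ.^ m)

sign-suc : ∀ m → sign (suc m) ≡ ℚ.- sign m
sign-suc m = trans (fromℤ-* -1ℤ (-1ℤ ℤ.^ m))
  (trans (sym (ℚ.neg-distribˡ-* 1ℚ (sign m))) (cong (λ q → ℚ.- q) (ℚ.*-identityˡ (sign m))))

-- The matchings between unit blocks that, once contracted, leave n - k blocks.
Completes : ℕ → (Fin ℓ → ℕ) → (Fin n → Fin ℓ) → List (Fin n × Fin n) → Set
Completes {ℓ} {n} k w π M =
  All (λ (x , y) → w (π x) ≡ 1 × w (π y) ≡ 1) M × AllPairs Disjoint M × length M ℕ.+ n ≡ k ℕ.+ ℓ

completes? : ∀ k (w : Fin ℓ → ℕ) (π : Fin n → Fin ℓ) M → Dec (Completes k w π M)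
completes? {ℓ} {n} k w π M =
  All.all? (λ (x , y) → (w (π x) ℕ.≟ 1) ×-dec (w (π y) ℕ.≟ 1)) M
  ×-dec allPairs? disjoint? M ×-dec (length M ℕ.+ n ℕ.≟ k ℕ.+ ℓ)

-- The expected coefficient in the middle of the recursion, when the edges `es` are still undecided;
-- the sign counts only the contractions still to come.
signedMatchings : ℕ → (Fin ℓ → ℕ) → (Fin n → Fin ℓ) → List (Fin n × Fin n) → ℚ
signedMatchings k w π es = ∑ (sublists es) (λ M → ⟦ completes? k w π M ⟧ ℚ.* sign (length M))

-- The state after the contraction of a matching: blocks are single vertices or matched pairs. By
-- `units`, a block of weight 1 holds no two vertices; `oriented` and `distinct` together allow each
-- edge only once and in one direction.
record Small (w : Fin ℓ → ℕ) (π : Fin n → Fin ℓ) (es : List (Fin n × Fin n)) : Set where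
  field
    nonempty  : ∀ i → 0 < w i
    ≤2        : ∀ i → w i ≤ 2
    total     : sum (tabulate w) ≡ n
    units     : ∀ {x y} → w (π x) ≡ 1 → π x ≡ π y → x ≡ y
    loopless  : All (λ (x , y) → π x ≢ π y) es
    oriented  : All (λ (x , y) → x Fin.< y) es
    distinct  : Unique es

small-tail : ∀ {w : Fin ℓ → ℕ} {π : Fin n → Fin ℓ} {e es} → Small w π (e ∷ es) → Small w π es
small-tail S = record
  { Small S
  ; loopless = All.tail (Small.loopless S)
  ; oriented = All.tail (Small.oriented S)
  ; distinct = tail (Small.distinct S)
  }
  where
  tail : ∀ {e es} → Unique (e ∷ es) → Unique {A = Fin _ × Fin _} es
  tail (_ ∷ d) = d

module _ {w : Fin (suc ℓ) → ℕ} {π : Fin n → Fin (suc ℓ)} {x y es}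
         (S : Small w π ((x , y) ∷ es)) (u≢v : π x ≢ π y) (wu≡1 : w (π x) ≡ 1) (wv≡1 : w (π y) ≡ 1) where
  open Small S

  private
    w′ : Fin ℓ → ℕ
    w′ = mergeWeights u≢v w

    π′ : Fin n → Fin ℓ
    π′ = identify u≢v ∘ π

    w′u≢1 : ∀ {z} → π x ≡ π z → w′ (π′ z) ≢ 1
    w′u≢1 {z} eq w′≡1 with () ← trans (sym (cong₂ ℕ._+_ wu≡1 wv≡1)) (trans
      (sym (mergeWeights-identify-u u≢v w)) (trans (cong (w′ ∘ identify u≢v) eq) w′≡1))

    w′v≢1 : ∀ {z} → π y ≡ π z → w′ (π′ z) ≢ 1
    w′v≢1 {z} eq w′≡1 with () ← trans (sym (cong₂ ℕ._+_ wu≡1 wv≡1)) (trans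
      (sym (mergeWeights-identify-v u≢v w)) (trans (cong (w′ ∘ identify u≢v) eq) w′≡1))

  -- The merged block has weight 2, so the weights themselves remember which vertices are already
  -- matched. Disjointness from `(x , y)` thereby becomes the condition of having weight 1 after the
  -- merge.
  unit-merge⁺ : ∀ {z} → x ≢ z → y ≢ z → w (π z) ≡ 1 → w′ (π′ z) ≡ 1
  unit-merge⁺ x≢z y≢z wz≡1 =
    trans (mergeWeights-identify u≢v w (x≢z ∘ units wu≡1) (y≢z ∘ units wv≡1)) wz≡1

  unit-merge⁻ : ∀ {z} → w′ (π′ z) ≡ 1 → x ≢ z × y ≢ z × w (π z) ≡ 1
  unit-merge⁻ w′≡1 = (λ x≡z → u≢z (cong π x≡z)) , (λ y≡z → v≢z (cong π y≡z)) ,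
    trans (sym (mergeWeights-identify u≢v w u≢z v≢z)) w′≡1
    where
    u≢z = λ eq → w′u≢1 eq w′≡1
    v≢z = λ eq → w′v≢1 eq w′≡1

  small-merge : Small w′ π′ es
  small-merge = record
    { nonempty = mergeWeights-positive u≢v nonempty
    ; ≤2       = λ i → ≤2′ i
    ; total    = trans (sum-mergeWeights u≢v w) total
    ; units    = units′
    ; loopless = All.tabulate loopless′
    ; oriented = All.tail oriented
    ; distinct = Small.distinct (small-tail S)
    }
    where
    ≤2′ : ∀ i → w′ i ≤ 2
    ≤2′ i with i Fin.≟ punchOut u≢v
    ... | yes refl = ℕ.≤-reflexive (trans (mergeWeights-merged u≢v w) (cong₂ ℕ._+_ wu≡1 wv≡1))
    ... | no i≢v   = ℕ.≤-trans (ℕ.≤-reflexive (mergeWeights-unmerged u≢v w i≢v)) (≤2 (punchIn (π x) i))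

    units′ : ∀ {a b} → w′ (π′ a) ≡ 1 → π′ a ≡ π′ b → a ≡ b
    units′ w′≡1 eq with identify-≡ u≢v eq
    ... | inj₁ πa≡πb              = units (proj₂ (proj₂ (unit-merge⁻ w′≡1))) πa≡πb
    ... | inj₂ (inj₁ (πa≡u , _)) = contradiction w′≡1 (w′u≢1 (sym πa≡u))
    ... | inj₂ (inj₂ (πa≡v , _)) = contradiction w′≡1 (w′v≢1 (sym πa≡v))

    -- A new loop would join the two merged blocks. These hold only `x` and `y`, so the edge would
    -- be `(x , y)`, against `distinct`, or `(y , x)`, against `oriented`.
    loopless′ : ∀ {e} → e ∈ es → π′ (proj₁ e) ≢ π′ (proj₂ e)
    loopless′ {a , b} ab∈ eq with identify-≡ u≢v eq | distinct
    ... | inj₁ πa≡πb | _ = All.lookup (All.tail loopless) ab∈ πa≡πb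
    ... | inj₂ (inj₁ (πa≡u , πb≡v)) | xy∉ ∷ _ =
      All.lookup xy∉ ab∈ (cong₂ _,_ (units wu≡1 (sym πa≡u)) (units wv≡1 (sym πb≡v)))
    ... | inj₂ (inj₂ (πa≡v , πb≡u)) | _
      rewrite sym (units wv≡1 (sym πa≡v)) | sym (units wu≡1 (sym πb≡u)) =
      Fin.<-asym (All.head oriented) (All.lookup (All.tail oriented) ab∈)

  completes-merge⁺ : ∀ {k M} → Completes k w π ((x , y) ∷ M) → Completes k w′ π′ M
  completes-merge⁺ {k} (_ ∷ unit , xy#M ∷ disjoint , size) =
    All.zipWith (λ ((wa≡1 , wb≡1) , (x≢a , x≢b , y≢a , y≢b)) →
      unit-merge⁺ x≢a y≢a wa≡1 , unit-merge⁺ x≢b y≢b wb≡1) (unit , xy#M) ,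
    disjoint , ℕ.suc-injective (trans size (ℕ.+-suc k ℓ))

  completes-merge⁻ : ∀ {k M} → Completes k w′ π′ M → Completes k w π ((x , y) ∷ M)
  completes-merge⁻ {k} (unit , disjoint , size) =
    (wu≡1 , wv≡1) ∷ All.map (λ (a≡1 , b≡1) → proj₂ (proj₂ (unit-merge⁻ a≡1)) , proj₂ (proj₂ (unit-merge⁻ b≡1))) unit ,
    All.map (λ (a≡1 , b≡1) → proj₁ (unit-merge⁻ a≡1) , proj₁ (unit-merge⁻ b≡1) ,
      proj₁ (proj₂ (unit-merge⁻ a≡1)) , proj₁ (proj₂ (unit-merge⁻ b≡1))) unit ∷ disjoint ,
    trans (cong suc size) (sym (ℕ.+-suc k ℓ))

  signedMatchings-merge : ∀ k →
    ∑ (sublists es) (λ M → ⟦ completes? k w π ((x , y) ∷ M) ⟧ ℚ.* sign (suc (length M))) ≡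
    ℚ.- signedMatchings k w′ π′ es
  signedMatchings-merge k = trans (∑-cong (sublists es) (λ M → trans
    (cong₂ ℚ._*_ (⟦⟧-cong (completes? k w π ((x , y) ∷ M)) (completes? k w′ π′ M)
      completes-merge⁺ completes-merge⁻) (sign-suc (length M)))
    (sym (ℚ.neg-distribʳ-* ⟦ completes? k w′ π′ M ⟧ (sign (length M))))))
    (∑-neg (sublists es) (λ M → ⟦ completes? k w′ π′ M ⟧ ℚ.* sign (length M)))

1∨2 : ∀ {m} → 0 < m → m ≤ 2 → m ≡ 1 ⊎ m ≡ 2
1∨2 {1} _ _ = inj₁ refl
1∨2 {2} _ _ = inj₂ refl
1∨2 {suc (suc (suc _))} _ (s≤s (s≤s ()))

-- Sublists containing `(x , y)` account for the contraction, the others for the deletion. If an end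
-- has weight 2, the contraction yields a block of weight at least 3 while no counted matching
-- contains the edge, so both sides are 0. When no edge is left, only the empty matching remains,
-- and its condition `n = k + ℓ` fixes the number of blocks and with it their sizes.
collect-signedMatchings : ∀ {w : Fin ℓ → ℕ} {π : Fin n → Fin ℓ} es (S : Small w π es) {k j} →
  n ≡ k ℕ.+ (k ℕ.+ j) →
  collect (terms w (Small.nonempty S) π es) (twosOnes k j) ≡ signedMatchings k w π es
collect-signedMatchings {ℓ} {n} {w} {π} [] S {k} {j} n≡ = cong (ℚ._+ 0ℚ) (trans
  (ℚ.*-comm 1ℚ ⟦ blockSizes w nonempty ≟ᴾ twosOnes k j ⟧)
  (cong (ℚ._* 1ℚ) (⟦⟧-cong (blockSizes w nonempty ≟ᴾ twosOnes k j) (completes? k w π [])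
    (λ eq → [] , [] , trans n≡ (cong (k ℕ.+_) (sym (blockSizes≡twosOnes⇒ {w>0 = nonempty} {k} j eq))))
    (λ (_ , _ , n≡k+ℓ) → ⇒blockSizes≡twosOnes {w>0 = nonempty} {k} {j} ≤2 (trans total n≡)
      (ℕ.+-cancelˡ-≡ k ℓ (k ℕ.+ j) (trans (sym n≡k+ℓ) n≡))))))
  where open Small S
collect-signedMatchings {zero} {π = π} ((x , _) ∷ _) S n≡ with () ← π x
collect-signedMatchings {suc ℓ} {n} {w} {π} ((x , y) ∷ es) S {k} {j} n≡ with π x Fin.≟ π y
... | yes πx≡πy = contradiction πx≡πy (All.head (Small.loopless S))
... | no u≢v = begin
  collect (terms w nonempty π es ⊖ T′) (twosOnes k j)
    ≡⟨ ∑-⊖ (terms w nonempty π es) T′ (λ μ → ⟦ μ ≟ᴾ twosOnes k j ⟧) ⟩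
  collect (terms w nonempty π es) (twosOnes k j) ℚ.- collect T′ (twosOnes k j)
    -- `sublists` lists the sublists containing the first edge before the others.
    ≡⟨ ℚ.+-comm (collect (terms w nonempty π es) (twosOnes k j)) _ ⟩
  ℚ.- collect T′ (twosOnes k j) ℚ.+ collect (terms w nonempty π es) (twosOnes k j)
    ≡⟨ cong₂ ℚ._+_ (contracted (1∨2 (nonempty (π x)) (≤2 (π x))) (1∨2 (nonempty (π y)) (≤2 (π y))))
         (collect-signedMatchings es (small-tail S) n≡) ⟩
  ∑ (sublists es) (λ M → f ((x , y) ∷ M)) ℚ.+ ∑ (sublists es) f
    ≡⟨ cong (ℚ._+ ∑ (sublists es) f) (∑-map ((x , y) ∷_) (sublists es) f) ⟨
  ∑ (map ((x , y) ∷_) (sublists es)) f ℚ.+ ∑ (sublists es) f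
    ≡⟨ ∑-++ (map ((x , y) ∷_) (sublists es)) (sublists es) f ⟨
  signedMatchings k w π ((x , y) ∷ es) ∎
  where
  open Small S

  f : List (Fin n × Fin n) → ℚ
  f M = ⟦ completes? k w π M ⟧ ℚ.* sign (length M)

  T′ : Combination
  T′ = terms (mergeWeights u≢v w) (mergeWeights-positive u≢v nonempty) (identify u≢v ∘ π) es

  heavy : 3 ≤ w (π x) ℕ.+ w (π y) → ¬ (w (π x) ≡ 1 × w (π y) ≡ 1) →
    ℚ.- collect T′ (twosOnes k j) ≡ ∑ (sublists es) (λ M → f ((x , y) ∷ M))
  heavy ≥3 ¬units = trans
    (cong (λ q → ℚ.- q) (collect-heavy (mergeWeights-positive u≢v nonempty) (identify u≢v ∘ π) es k j
      (punchOut u≢v , ℕ.≤-trans ≥3 (ℕ.≤-reflexive (sym (mergeWeights-merged u≢v w))))))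
    (sym (∑-zero (sublists es) (λ M → trans
      (cong (ℚ._* sign (suc (length M)))
        (⟦⟧-false (completes? k w π ((x , y) ∷ M)) (¬units ∘ All.head ∘ proj₁)))
      (ℚ.*-zeroˡ (sign (suc (length M)))))))

  contracted : w (π x) ≡ 1 ⊎ w (π x) ≡ 2 → w (π y) ≡ 1 ⊎ w (π y) ≡ 2 →
    ℚ.- collect T′ (twosOnes k j) ≡ ∑ (sublists es) (λ M → f ((x , y) ∷ M))
  contracted (inj₁ wu≡1) (inj₁ wv≡1) = trans
    (cong (λ q → ℚ.- q) (collect-signedMatchings es (small-merge S u≢v wu≡1 wv≡1) n≡))
    (sym (signedMatchings-merge S u≢v wu≡1 wv≡1 k))
  contracted (inj₂ wu≡2) _ = heavy (ℕ.+-mono-≤ (ℕ.≤-reflexive (sym wu≡2)) (nonempty (π y)))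
    (λ (wu≡1 , _) → contradiction (trans (sym wu≡1) wu≡2) λ ())
  contracted (inj₁ wu≡1) (inj₂ wv≡2) = heavy (ℕ.+-mono-≤ (nonempty (π x)) (ℕ.≤-reflexive (sym wv≡2)))
    (λ (_ , wv≡1) → contradiction (trans (sym wv≡1) wv≡2) λ ())

edges-small : ∀ (G : Graph n) → Small (λ _ → 1) id (edges G)
edges-small {n} G = record
  { nonempty = λ _ → s≤s z≤n
  ; ≤2       = λ _ → s≤s z≤n
  ; total    = sum-ones n
  ; units    = λ _ eq → eq
  ; loopless = All.map Fin.<⇒≢ oriented
  ; oriented = oriented
  ; distinct = Unique.filter⁺ (edge? G) (Unique.cartesianProduct⁺ (Unique.allFin⁺ n) (Unique.allFin⁺ n))
  }
  where
  oriented : All (λ (x , y) → x Fin.< y) (edges G)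
  oriented = All.tabulate (λ { {x , y} xy∈ → proj₁ (∈-edges⁻ G xy∈) })

  sum-ones : ∀ n → sum (tabulate {n = n} (λ _ → 1)) ≡ n
  sum-ones zero    = refl
  sum-ones (suc n) = cong suc (sum-ones n)

chromatic-terms : Graph n → Combination
chromatic-terms G = terms (λ _ → 1) (Small.nonempty (edges-small G)) id (edges G)

chromatic-expansion : ∀ (G : Graph n) → PowerSumExpansion (chromatic G) (collect (chromatic-terms G))
chromatic-expansion G = collect-expansion (chromatic-terms G) (λ r α → trans
  (chromatic≈weightedChromatic G r α)
  (weightedChromatic-terms (λ _ → 1) (Small.nonempty (edges-small G)) id (edges G) r α))

matching? : ∀ k (M : List (Fin n × Fin n)) → Dec (length M ≡ k × AllPairs Disjoint M)
matching? k M = (length M ℕ.≟ k) ×-dec allPairs? disjoint? M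

-- At the start `ℓ = n`, so the size condition cancels to `length M = k`, and the sign is constant
-- where the indicator is nonzero.
signedMatchings-edges : ∀ (G : Graph n) k →
  signedMatchings k (λ _ → 1) id (edges G) ≡ fromℤ ((-1ℤ ℤ.^ k) ℤ.* (+ #matchings G k))
signedMatchings-edges {n} G k = begin
  signedMatchings k (λ _ → 1) id (edges G)
    ≡⟨ ∑-cong (sublists (edges G)) summand ⟩
  ∑ (sublists (edges G)) (λ M → sign k ℚ.* ⟦ matching? k M ⟧)
    ≡⟨ ∑-*ˡ (sign k) (sublists (edges G)) (λ M → ⟦ matching? k M ⟧) ⟩
  sign k ℚ.* ∑ (sublists (edges G)) (λ M → ⟦ matching? k M ⟧)
    ≡⟨ cong (sign k ℚ.*_) (fromℕ-length-filter (matching? k) (sublists (edges G))) ⟨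
  sign k ℚ.* fromℕ (#matchings G k)
    ≡⟨ fromℤ-* (-1ℤ ℤ.^ k) (+ #matchings G k) ⟨
  fromℤ ((-1ℤ ℤ.^ k) ℤ.* (+ #matchings G k)) ∎
  where
  indicators : ∀ M → ⟦ completes? k (λ _ → 1) id M ⟧ ≡ ⟦ matching? k M ⟧
  indicators M = ⟦⟧-cong (completes? k (λ _ → 1) id M) (matching? k M)
    (λ (_ , disjoint , size) → ℕ.+-cancelʳ-≡ n (length M) k size , disjoint)
    (λ (size , disjoint) → All.universal (λ _ → refl , refl) M , disjoint , cong (ℕ._+ n) size)

  summand : ∀ M → ⟦ completes? k (λ _ → 1) id M ⟧ ℚ.* sign (length M) ≡ sign k ℚ.* ⟦ matching? k M ⟧
  summand M = trans (cong (ℚ._* sign (length M)) (indicators M)) (byLength (length M ℕ.≟ k))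
    where
    byLength : Dec (length M ≡ k) → ⟦ matching? k M ⟧ ℚ.* sign (length M) ≡ sign k ℚ.* ⟦ matching? k M ⟧
    byLength (yes size) = trans (ℚ.*-comm ⟦ matching? k M ⟧ (sign (length M)))
      (cong (λ m → sign m ℚ.* ⟦ matching? k M ⟧) size)
    byLength (no ¬size) = trans
      (trans (cong (ℚ._* sign (length M)) ⟦M⟧≡0) (ℚ.*-zeroˡ (sign (length M))))
      (sym (trans (cong (sign k ℚ.*_) ⟦M⟧≡0) (ℚ.*-zeroʳ (sign k))))
      where
      ⟦M⟧≡0 : ⟦ matching? k M ⟧ ≡ 0ℚ
      ⟦M⟧≡0 = ⟦⟧-false (matching? k M) (¬size ∘ proj₁)

coefficient-twosOnes : ∀ (G : Graph n) {c} → PowerSumExpansion (chromatic G) c → ∀ k → 2 * k ≤ n →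
  c (twosOnes k (n ∸ 2 * k)) ≡ fromℤ ((-1ℤ ℤ.^ k) ℤ.* (+ #matchings G k))
coefficient-twosOnes {n} G {c} E k 2k≤n = begin
  c (twosOnes k (n ∸ 2 * k))
    ≡⟨ expansion-unique E (chromatic-expansion G) (twosOnes k (n ∸ 2 * k)) ⟩
  collect (chromatic-terms G) (twosOnes k (n ∸ 2 * k))
    ≡⟨ collect-signedMatchings (edges G) (edges-small G) {k} {n ∸ 2 * k} n≡ ⟩
  signedMatchings k (λ _ → 1) id (edges G)
    ≡⟨ signedMatchings-edges G k ⟩
  fromℤ ((-1ℤ ℤ.^ k) ℤ.* (+ #matchings G k)) ∎
  where
  n≡ : n ≡ k ℕ.+ (k ℕ.+ (n ∸ 2 * k))
  n≡ = trans (sym (ℕ.m+[n∸m]≡n 2k≤n))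
    (trans (cong (λ m → k ℕ.+ m ℕ.+ (n ∸ 2 * k)) (ℕ.+-identityʳ k)) (ℕ.+-assoc k k (n ∸ 2 * k)))

-- The matching polynomial

sublists-⊆ : ∀ {A : Set} (xs : List A) {ys} → ys ∈ sublists xs → ys ⊆ xs
sublists-⊆ []       (here refl) = []
sublists-⊆ (x ∷ xs) ys∈ with ∈-++⁻ (map (x ∷_) (sublists xs)) ys∈
... | inj₂ ys∈′ = x ∷ʳ sublists-⊆ xs ys∈′
... | inj₁ ys∈′ with zs , zs∈ , refl ← ∈-map⁻ (x ∷_) ys∈′ = refl ∷ sublists-⊆ xs zs∈

unique-lookup : ∀ {A : Set} {xs : List A} → Unique xs → ∀ {i j} → List.lookup xs i ≡ List.lookup xs j → i ≡ j
unique-lookup (x∉ ∷ u) {zero}  {zero}  eq = refl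
unique-lookup (x∉ ∷ u) {zero}  {suc j} eq = contradiction eq (All.lookup x∉ (∈-lookup j))
unique-lookup (x∉ ∷ u) {suc i} {zero}  eq = contradiction (sym eq) (All.lookup x∉ (∈-lookup i))
unique-lookup (x∉ ∷ u) {suc i} {suc j} eq = cong suc (unique-lookup u eq)

unique-length : ∀ {xs : List (Fin n)} → Unique xs → length xs ≤ n
unique-length u = Fin.injective⇒≤ (unique-lookup u)

endpoints : List (Fin n × Fin n) → List (Fin n)
endpoints []            = []
endpoints ((x , y) ∷ M) = x ∷ y ∷ endpoints M

length-endpoints : ∀ (M : List (Fin n × Fin n)) → length (endpoints M) ≡ 2 * length M
length-endpoints []      = refl
length-endpoints (_ ∷ M) = trans (cong (λ m → suc (suc m)) (length-endpoints M))
  (cong suc (sym (ℕ.+-suc (length M) (length M ℕ.+ 0))))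

endpoints-∉ : ∀ {z} {M : List (Fin n × Fin n)} →
  All (λ (x , y) → z ≢ x × z ≢ y) M → All (z ≢_) (endpoints M)
endpoints-∉ []                  = []
endpoints-∉ ((z≢x , z≢y) ∷ z∉M) = z≢x ∷ z≢y ∷ endpoints-∉ z∉M

endpoints-unique : ∀ {M : List (Fin n × Fin n)} →
  All (λ (x , y) → x ≢ y) M → AllPairs Disjoint M → Unique (endpoints M)
endpoints-unique []             []                = []
endpoints-unique (x≢y ∷ M-loopless) (xy#M ∷ disjoint) =
  (x≢y ∷ endpoints-∉ (All.map (λ (x≢a , x≢b , _) → x≢a , x≢b) xy#M)) ∷
  endpoints-∉ (All.map (λ (_ , _ , y≢a , y≢b) → y≢a , y≢b) xy#M) ∷
  endpoints-unique M-loopless disjoint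

-- The two polynomials to be compared are cut off at different degrees, the number of edges and
-- `⌊ n /2⌋`. Beyond either there is no matching, since its edges are a sublist of `edges G` and its
-- 2k endpoints are distinct.
matching-bounds : ∀ (G : Graph n) {k M} → M ∈ sublists (edges G) → length M ≡ k × AllPairs Disjoint M →
  k ≤ length (edges G) × 2 * k ≤ n
matching-bounds G {M = M} M∈ (refl , disjoint) = length-mono-≤ M⊆ ,
  ℕ.≤-trans (ℕ.≤-reflexive (sym (length-endpoints M)))
    (unique-length (endpoints-unique (All-resp-⊆ M⊆ (Small.loopless (edges-small G))) disjoint))
  where
  M⊆ : M ⊆ edges G
  M⊆ = sublists-⊆ (edges G) M∈

#matchings-vanishes : ∀ (G : Graph n) {k} → ¬ (k ≤ length (edges G) × 2 * k ≤ n) → #matchings G k ≡ 0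
#matchings-vanishes G {k} ¬bounds =
  cong length (filter-none (matching? k) (All.tabulate (λ M∈ M-matching → ¬bounds (matching-bounds G M∈ M-matching))))

coeff-applyUpTo : ∀ (a : ℕ → ℚ) f d j → j < d → coeff (map a (applyUpTo f d)) j ≡ a (f j)
coeff-applyUpTo a f (suc d) zero    _         = refl
coeff-applyUpTo a f (suc d) (suc j) (s≤s j<d) = coeff-applyUpTo a (f ∘ suc) d j j<d

coeff-applyUpTo-≥ : ∀ (a : ℕ → ℚ) f d j → d ≤ j → coeff (map a (applyUpTo f d)) j ≡ 0ℚ
coeff-applyUpTo-≥ a f zero    j       _         = refl
coeff-applyUpTo-≥ a f (suc d) (suc j) (s≤s d≤j) = coeff-applyUpTo-≥ a (f ∘ suc) d j d≤j

coeff-∑≤ : ∀ d {a b : ℕ → ℚ} → (∀ j → j ≤ d → a j ≡ b j) → (∀ j → d < j → b j ≡ 0ℚ) →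
           ∀ j → coeff (∑≤ d a) j ≡ b j
coeff-∑≤ d {a} a≡b b≡0 j with j ℕ.≤? d
... | yes j≤d = trans (coeff-applyUpTo a id (suc d) j (s≤s j≤d)) (a≡b j j≤d)
... | no j≰d  = trans (coeff-applyUpTo-≥ a id (suc d) j (ℕ.≰⇒> j≰d)) (sym (b≡0 j (ℕ.≰⇒> j≰d)))

∣sign∣ : ∀ k → ∣ sign k ∣ ≡ 1ℚ
∣sign∣ zero    = refl
∣sign∣ (suc k) = trans (cong ∣_∣ (sign-suc k)) (trans (ℚ.∣-p∣≡∣p∣ (sign k)) (∣sign∣ k))

∣signed∣ : ∀ k m → ∣ fromℤ ((-1ℤ ℤ.^ k) ℤ.* (+ m)) ∣ ≡ fromℕ m
∣signed∣ k m = begin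
  ∣ fromℤ ((-1ℤ ℤ.^ k) ℤ.* (+ m)) ∣  ≡⟨ cong ∣_∣ (fromℤ-* (-1ℤ ℤ.^ k) (+ m)) ⟩
  ∣ sign k ℚ.* fromℕ m ∣             ≡⟨ ℚ.∣p*q∣≡∣p∣*∣q∣ (sign k) (fromℕ m) ⟩
  ∣ sign k ∣ ℚ.* ∣ fromℕ m ∣         ≡⟨ cong (ℚ._* ∣ fromℕ m ∣) (∣sign∣ k) ⟩
  1ℚ ℚ.* ∣ fromℕ m ∣                 ≡⟨ ℚ.*-identityˡ ∣ fromℕ m ∣ ⟩
  ∣ fromℕ m ∣                        ≡⟨ ℚ.0≤p⇒∣p∣≡p (ℚ.nonNegative⁻¹ (fromℕ m) {{ℚ.normalize-nonNeg m 1}}) ⟩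
  fromℕ m                            ∎

coeff-matchingPolynomial : ∀ (G : Graph n) j → coeff (matchingPolynomial G) j ≡ fromℕ (#matchings G j)
coeff-matchingPolynomial G = coeff-∑≤ (length (edges G)) (λ _ _ → refl)
  (λ j j> → cong fromℕ (#matchings-vanishes G (ℕ.<⇒≱ j> ∘ proj₁)))

≤⌊/2⌋⇒2*≤ : ∀ {j n} → j ≤ ⌊ n /2⌋ → 2 * j ≤ n
≤⌊/2⌋⇒2*≤ {j} {n} j≤ = ℕ.≤-trans (ℕ.*-monoʳ-≤ 2 j≤) (ℕ.≤-trans
  (ℕ.≤-reflexive (cong (⌊ n /2⌋ ℕ.+_) (ℕ.+-identityʳ ⌊ n /2⌋)))
  (ℕ.≤-trans (ℕ.+-monoʳ-≤ ⌊ n /2⌋ (ℕ.⌊n/2⌋≤⌈n/2⌉ n)) (ℕ.≤-reflexive (ℕ.⌊n/2⌋+⌈n/2⌉≡n n))))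

2*≤⇒≤⌊/2⌋ : ∀ {j n} → 2 * j ≤ n → j ≤ ⌊ n /2⌋
2*≤⇒≤⌊/2⌋ {j} {n} 2j≤n = ℕ.≤-trans (ℕ.≤-reflexive (ℕ.n≡⌊n+n/2⌋ j))
  (ℕ.⌊n/2⌋-mono (ℕ.≤-trans (ℕ.≤-reflexive (cong (j ℕ.+_) (sym (ℕ.+-identityʳ j)))) 2j≤n))

matchingPolynomial-coefficients : ∀ (G : Graph n) {c} → PowerSumExpansion (chromatic G) c →
  matchingPolynomial G ≈ᴾ ∑≤ ⌊ n /2⌋ (λ k → ∣ c (twosOnes k (n ∸ 2 * k)) ∣)
matchingPolynomial-coefficients {n} G E j = trans (coeff-matchingPolynomial G j) (sym (coeff-∑≤ ⌊ n /2⌋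
  (λ k k≤ → trans (cong ∣_∣ (coefficient-twosOnes G E k (≤⌊/2⌋⇒2*≤ k≤))) (∣signed∣ k (#matchings G k)))
  (λ k k> → cong fromℕ (#matchings-vanishes G (ℕ.<⇒≱ k> ∘ 2*≤⇒≤⌊/2⌋ ∘ proj₂))) j))

PowerSumExpansion-resp-≈ : ∀ {f g c} → f ≈ g → PowerSumExpansion f c → PowerSumExpansion g c
PowerSumExpansion-resp-≈ f≈g E = record
  { PowerSumExpansion E
  ; expansion = λ r α → trans (sym (f≈g r α)) (PowerSumExpansion.expansion E r α)
  }

-- One expansion serves both graphs. The number of vertices must be recovered beforehand, because it
-- selects the coefficients through `n ∸ 2 * k`.
chromatic-determines-matchingPolynomial : ∀ {m} (G : Graph n) (H : Graph m) →
  chromatic G ≈ chromatic H → matchingPolynomial G ≈ᴾ matchingPolynomial H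
chromatic-determines-matchingPolynomial G H G≈H = sameOrder (chromatic-determines-order G H G≈H) H G≈H
  where
  -- `H` and the hypothesis on it are quantified anew so that the equation between the orders can be
  -- matched with `refl`.
  sameOrder : ∀ {m} → _ ≡ m → (H : Graph m) → chromatic G ≈ chromatic H →
              matchingPolynomial G ≈ᴾ matchingPolynomial H
  sameOrder refl H G≈H j = trans (matchingPolynomial-coefficients G (chromatic-expansion G) j)
    (sym (matchingPolynomial-coefficients H (PowerSumExpansion-resp-≈ G≈H (chromatic-expansion G)) j))

theorem1 : ∀ {n} (G : Graph n) → Forest G →
    (∃[ c ] PowerSumExpansion (chromatic G) c)
    × (∀ c → PowerSumExpansion (chromatic G) c →
        (∀ k → 2 * k ≤ n → c (twosOnes k (n ∸ 2 * k)) ≡ fromℤ ((-1ℤ ℤ.^ k) ℤ.* (+ #matchings G k)))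
        × (matchingPolynomial G ≈ᴾ ∑≤ ⌊ n /2⌋ (λ k → ∣ c (twosOnes k (n ∸ 2 * k)) ∣)))
    × (∀ {m} (H : Graph m) → Forest H → chromatic G ≈ chromatic H → matchingPolynomial G ≈ᴾ matchingPolynomial H)
theorem1 G _ =
  (collect (chromatic-terms G) , chromatic-expansion G) ,
  (λ c E → coefficient-twosOnes G E , matchingPolynomial-coefficients G E) ,
  (λ H _ → chromatic-determines-matchingPolynomial G H)
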